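{- Let $n>1$ be an odd integer. Then $G_n^\star$ is cyclic if and only if either $n=p^\alpha$, or $n=p^\alpha q^\beta$ with $\gcd\big(\varphi(p^\alpha),\varphi(q^\beta)\big)=2$, where $p,q$ are distinct odd primes and $\alpha,\beta$ are positive integers.
   Context: For a positive integer $n$ and integers $a,b$ coprime to $n$, write $a\equiv b\ (\mathrm{mod}^\star\, n)$ if $a-b\in n\mathbb{Z}$ or $a+b\in n\mathbb{Z}$. $G_n^\star$ denotes the group of equivalence classes of integers coprime to $n$ under this relation, with multiplication $[a][b]=[ab]$ (equivalently $G_n^\star\cong(\mathbb{Z}/n\mathbb{Z})^\times/\langle -1\rangle$). $\varphi$ is Euler's totient function. -}

module Defs where

open import Data.Nat as ℕ using (ℕ; suc)
open import Data.Nat.Coprimality using (Coprime; coprime?)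
open import Data.List using (length; filter; map; upTo)
open import Data.Integer as ℤ using (ℤ; +_; ∣_∣)
open import Data.Integer.Divisibility using (_∣_)
open import Data.Product using (Σ; _×_)
open import Data.Sum using (_⊎_)

φ : ℕ → ℕ
φ n = length (filter (λ k → coprime? k n) (map suc (upTo n)))

_≡⋆_[mod_] : ℤ → ℤ → ℕ → Set
a ≡⋆ b [mod n ] = ((+ n) ∣ (a ℤ.- b)) ⊎ ((+ n) ∣ (a ℤ.+ b))

-- G⋆_n is cyclic: there is a class [g] (g coprime to n) such that every
-- class [a] (a coprime to n) is a power [g]^k = [g^k].
G⋆-cyclic : ℕ → Set
G⋆-cyclic n =
  Σ ℤ λ g → Coprime ∣ g ∣ n ×
    ((a : ℤ) → Coprime ∣ a ∣ n → Σ ℕ λ k → a ≡⋆ (g ℤ.^ k) [mod n ])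

{-# OPTIONS --safe #-}

-- Modulo an odd prime power there is a primitive root.  Modulo p, one enlarges the order N of an
-- element until x^N ≡ 1 holds for every unit x; as X^N - 1 has at most N roots, the powers of that
-- element are then all the units.  It lifts to p^α as soon as its N-th power is not 1 modulo p².
--
-- For P = p^α and Q = q^β with primitive roots g and h and gcd (φ P) (φ Q) = 2, one of φ P, φ Q is
-- twice an odd number, say φ Q.  Then exactly one of x, -x is a square modulo Q, and the class of
-- the w with w ≡ g (mod P) and w ≡ h² (mod Q) generates.
--
-- Conversely, if every unit is ± a power of one element, then the d-th powers have index at most 2d
-- in the group of units.  This index is at least d² for n = P Q and d = gcd (φ P) (φ Q), and at
-- least 8 for d = 2 if n has three prime factors.

module Submission where

open import Defs
open import Data.Fin as Fin using (Fin; combine; fromℕ<; remQuot; toℕ)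
import Data.Fin.Properties as Fin
open import Data.Integer using (ℤ; +_; -[1+_]; -_; _+_; _-_; 0ℤ; 1ℤ; ∣_∣; _%ℕ_; _/ℕ_)
import Data.Integer.Divisibility as ℤᵤ
import Data.Integer.Divisibility.Signed as ℤₛ
open import Data.Integer.DivMod using (a≡a%ℕn+[a/ℕn]*n; n%ℕd<d)
open import Data.Integer.Properties using (*-identityˡ; *-identityʳ; *-comm; *-assoc; *-cancelʳ-≡; ^-distribˡ-+-*; ^-*-assoc; ^-zeroˡ; pos-*; pos-+; abs-*; +-injective)
open import Data.Integer.Tactic.RingSolver using (solve-∀)
open import Data.List using (List; []; _∷_; applyUpTo; filter; length; lookup; map; replicate; upTo)
open import Data.List.Membership.Propositional using (_∈_)
open import Data.List.Membership.Propositional.Properties using (∈-lookup; ∈-filter⁺; ∈-filter⁻; ∈-map⁺; ∈-map⁻; ∈-upTo⁺; ∈-upTo⁻; ∈-applyUpTo⁺; ∈-applyUpTo⁻)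
open import Data.List.Properties using (length-applyUpTo; length-replicate)
open import Data.List.Relation.Binary.Subset.Propositional using (_⊆_)
open import Data.List.Relation.Unary.All as All using (All; []; _∷_)
import Data.List.Relation.Unary.All.Properties as All
open import Data.List.Relation.Unary.AllPairs using (AllPairs; []; _∷_)
import Data.List.Relation.Unary.AllPairs.Properties as AllPairs
open import Data.List.Relation.Unary.Any using (index)
open import Data.List.Relation.Unary.Any.Properties using (lookup-index)
open import Data.List.Relation.Unary.Unique.Propositional using (Unique)
import Data.List.Relation.Unary.Unique.Propositional.Properties as Unique
open import Data.Nat as ℕ using (ℕ; zero; suc; NonZero)
open import Data.Nat.Coprimality as Coprimality using (Coprime; coprime?; coprime-Bézout; coprime-divisor)
import Data.Nat.Divisibility as ℕ
import Data.Nat.DivMod as ℕ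
open import Data.Nat.GCD using (module Bézout; gcd; gcd-greatest; gcd[m,n]∣m; gcd[m,n]∣n; gcd[m,n]≢0)
open import Data.Nat.Induction using (<-rec)
open import Data.Nat.Primality using (Prime; prime[2]; euclidsLemma; prime⇒irreducible; prime⇒nonZero; prime⇒nonTrivial)
open import Data.Nat.Primality.Factorisation using (factorise)
import Data.Nat.Properties as ℕ
open import Data.Product using (Σ; ∃; _×_; _,_; proj₁; proj₂)
open import Data.Sum using (_⊎_; inj₁; inj₂; [_,_]′)
open import Function using (_∘_; id)
open import Function.Bundles using (_⇔_; mk⇔)
open import Relation.Binary.Bundles using (Setoid)
open import Relation.Binary.PropositionalEquality using (_≡_; _≢_; refl; sym; trans; cong; cong₂; subst; module ≡-Reasoning)
open import Relation.Nullary using (¬_; Dec; yes; no; contradiction; ¬?)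
open import Relation.Nullary.Decidable using (_×-dec_; decidable-stable; map′)
open import Relation.Unary using (Decidable)

module Congruence where
  open import Data.Integer using (_*_; _^_)

  private variable
    x y z x′ y′ m m′ : ℤ

  infix 4 _≈_[_] _≈?_[_]

  record _≈_[_] (x y m : ℤ) : Set where
    constructor congruent
    field
      quotient : ℤ
      equality : x ≡ y + quotient * m

  ≡⇒≈ : x ≡ y → x ≈ y [ m ]
  ≡⇒≈ {x} {_} {m} refl = congruent 0ℤ (lemma x m)
    where
    lemma : ∀ x m → x ≡ x + 0ℤ * m
    lemma = solve-∀

  ≈-refl : x ≈ x [ m ]
  ≈-refl = ≡⇒≈ refl

  ≈-sym : x ≈ y [ m ] → y ≈ x [ m ]
  ≈-sym {y = y} {m} (congruent s refl) = congruent (- s) (lemma y s m)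
    where
    lemma : ∀ y s m → y ≡ y + s * m + - s * m
    lemma = solve-∀

  ≈-trans : x ≈ y [ m ] → y ≈ z [ m ] → x ≈ z [ m ]
  ≈-trans {m = m} {z} (congruent s refl) (congruent t refl) = congruent (t + s) (lemma z s t m)
    where
    lemma : ∀ z s t m → z + t * m + s * m ≡ z + (t + s) * m
    lemma = solve-∀

  ≈-setoid : ℤ → Setoid _ _
  ≈-setoid m = record
    { Carrier = ℤ
    ; _≈_ = _≈_[ m ]
    ; isEquivalence = record { refl = ≈-refl ; sym = ≈-sym ; trans = ≈-trans }
    }

  module ≈-Reasoning (m : ℤ) where
    open import Relation.Binary.Reasoning.Setoid (≈-setoid m) public

  +-cong : x ≈ x′ [ m ] → y ≈ y′ [ m ] → x + y ≈ x′ + y′ [ m ]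
  +-cong {x′ = x} {m} {y′ = y} (congruent s refl) (congruent t refl) =
    congruent (s + t) (lemma x s y t m)
    where
    lemma : ∀ x s y t m → x + s * m + (y + t * m) ≡ x + y + (s + t) * m
    lemma = solve-∀

  *-cong : x ≈ x′ [ m ] → y ≈ y′ [ m ] → x * y ≈ x′ * y′ [ m ]
  *-cong {x′ = x} {m} {y′ = y} (congruent s refl) (congruent t refl) =
    congruent (s * y + x * t + s * t * m) (lemma x s y t m)
    where
    lemma : ∀ x s y t m → (x + s * m) * (y + t * m) ≡ x * y + (s * y + x * t + s * t * m) * m
    lemma = solve-∀

  *-congˡ : ∀ x → y ≈ z [ m ] → x * y ≈ x * z [ m ]
  *-congˡ x = *-cong (≈-refl {x})

  *-congʳ : ∀ x → y ≈ z [ m ] → y * x ≈ z * x [ m ]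
  *-congʳ x y≈z = *-cong y≈z (≈-refl {x})

  +-congˡ : ∀ x → y ≈ z [ m ] → x + y ≈ x + z [ m ]
  +-congˡ x = +-cong (≈-refl {x})

  neg-cong : x ≈ y [ m ] → - x ≈ - y [ m ]
  neg-cong {y = y} {m} (congruent s refl) = congruent (- s) (lemma y s m)
    where
    lemma : ∀ y s m → - (y + s * m) ≡ - y + - s * m
    lemma = solve-∀

  ^-cong : ∀ k → x ≈ y [ m ] → x ^ k ≈ y ^ k [ m ]
  ^-cong zero    _   = ≈-refl
  ^-cong (suc k) x≈y = *-cong x≈y (^-cong k x≈y)

  ≈1⇒^≈1 : ∀ k → x ≈ 1ℤ [ m ] → x ^ k ≈ 1ℤ [ m ]
  ≈1⇒^≈1 k x≈1 = ≈-trans (^-cong k x≈1) (≡⇒≈ (^-zeroˡ k))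

  ^-distribʳ-* : ∀ x y k → (x * y) ^ k ≡ x ^ k * y ^ k
  ^-distribʳ-* x y zero    = refl
  ^-distribʳ-* x y (suc k) =
    trans (cong (x * y *_) (^-distribʳ-* x y k)) (lemma x y (x ^ k) (y ^ k))
    where
    lemma : ∀ x y u v → x * y * (u * v) ≡ x * u * (y * v)
    lemma = solve-∀

  ≈⇒∣ : x ≈ y [ m ] → m ℤᵤ.∣ x - y
  ≈⇒∣ {x} {y} {m} (congruent s refl) = ℤₛ.∣⇒∣ᵤ (ℤₛ.divides s (lemma y s m))
    where
    lemma : ∀ y s m → y + s * m - y ≡ s * m
    lemma = solve-∀

  ∣⇒≈ : m ℤᵤ.∣ x - y → x ≈ y [ m ]
  ∣⇒≈ {m} {x} {y} m∣x-y with ℤₛ.∣ᵤ⇒∣ {m} {x - y} m∣x-y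
  ... | ℤₛ.divides s eq = congruent s (trans (lemma x y) (cong (_+_ y) eq))
    where
    lemma : ∀ x y → x ≡ y + (x - y)
    lemma = solve-∀

  ≈0⇒∣ : x ≈ 0ℤ [ m ] → m ℤᵤ.∣ x
  ≈0⇒∣ {x} {m} (congruent s eq) = ℤₛ.∣⇒∣ᵤ (ℤₛ.divides s (trans eq (lemma s m)))
    where
    lemma : ∀ s m → 0ℤ + s * m ≡ s * m
    lemma = solve-∀

  ∣⇒≈0 : m ℤᵤ.∣ x → x ≈ 0ℤ [ m ]
  ∣⇒≈0 {m} {x} m∣x with ℤₛ.∣ᵤ⇒∣ {m} {x} m∣x
  ... | ℤₛ.divides s eq = congruent s (trans eq (lemma s m))
    where
    lemma : ∀ s m → s * m ≡ 0ℤ + s * m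
    lemma = solve-∀

  _≈?_[_] : ∀ x y m → Dec (x ≈ y [ m ])
  x ≈? y [ m ] = map′ ∣⇒≈ ≈⇒∣ (∣ m ∣ ℕ.∣? ∣ x - y ∣)

  ≈-*ˡ : ∀ m′ → x ≈ y [ m * m′ ] → x ≈ y [ m ]
  ≈-*ˡ {y = y} {m} m′ (congruent s refl) = congruent (s * m′) (lemma y s m m′)
    where
    lemma : ∀ y s m m′ → y + s * (m * m′) ≡ y + s * m′ * m
    lemma = solve-∀

  ≈-*ʳ : ∀ m → x ≈ y [ m * m′ ] → x ≈ y [ m′ ]
  ≈-*ʳ {y = y} {m′} m (congruent s refl) = congruent (s * m) (lemma y s m m′)
    where
    lemma : ∀ y s m m′ → y + s * (m * m′) ≡ y + s * m * m′
    lemma = solve-∀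

  %ℕ-≈ : ∀ x n .{{_ : ℕ.NonZero n}} → x ≈ + (x %ℕ n) [ + n ]
  %ℕ-≈ x n = congruent (x /ℕ n) (a≡a%ℕn+[a/ℕn]*n x n)

  record Unit (m x : ℤ) : Set where
    constructor _,_
    field
      inverse   : ℤ
      isInverse : x * inverse ≈ 1ℤ [ m ]

  unit-1 : Unit m 1ℤ
  unit-1 = 1ℤ , ≈-refl

  unit-* : Unit m x → Unit m y → Unit m (x * y)
  unit-* {m} {x} {y} (u , xu≈1) (v , yv≈1) =
    u * v , ≈-trans (≡⇒≈ (lemma x y u v)) (*-cong xu≈1 yv≈1)
    where
    lemma : ∀ x y u v → x * y * (u * v) ≡ x * u * (y * v)
    lemma = solve-∀

  unit-^ : ∀ k → Unit m x → Unit m (x ^ k)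
  unit-^ zero    _ = unit-1
  unit-^ (suc k) u = unit-* u (unit-^ k u)

  unit-neg : Unit m x → Unit m (- x)
  unit-neg {m} {x} (u , xu≈1) = - u , ≈-trans (≡⇒≈ (lemma x u)) xu≈1
    where
    lemma : ∀ x u → - x * - u ≡ x * u
    lemma = solve-∀

  unit-≈ : x ≈ y [ m ] → Unit m x → Unit m y
  unit-≈ x≈y (u , xu≈1) = u , ≈-trans (*-congʳ u (≈-sym x≈y)) xu≈1

  unit-*ˡ : ∀ m′ → Unit (m * m′) x → Unit m x
  unit-*ˡ m′ (u , xu≈1) = u , ≈-*ˡ m′ xu≈1

  unit-*ʳ : ∀ m → Unit (m * m′) x → Unit m′ x
  unit-*ʳ m (u , xu≈1) = u , ≈-*ʳ m xu≈1

  -- 1 - x w = (1 - x u) (1 - x v) for w = u + v - x u v.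
  unit-modulus-* : Unit m x → Unit m′ x → Unit (m * m′) x
  unit-modulus-* {m} {x} {m′} (u , congruent s xu≡1+sm) (v , congruent t xv≡1+tm) =
    u + v - x * u * v , congruent (- (s * t)) (trans (expand x u v)
      (trans (cong₂ (λ a b → a + b - a * b) xu≡1+sm xv≡1+tm) (collect s t m m′)))
    where
    expand : ∀ x u v → x * (u + v - x * u * v) ≡ x * u + x * v - x * u * (x * v)
    expand = solve-∀
    collect : ∀ s t m m′ → 1ℤ + s * m + (1ℤ + t * m′) - (1ℤ + s * m) * (1ℤ + t * m′)
                         ≡ 1ℤ + - (s * t) * (m * m′)
    collect = solve-∀

  unit-sym : Unit m x → Unit x m
  unit-sym {m} {x} (u , congruent s xu≡1+sm) = - s , congruent (- u) (begin
    m * - s                      ≡⟨ lemma₁ m s ⟩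
    1ℤ + - (1ℤ + s * m)          ≡⟨ cong (λ a → 1ℤ + - a) (sym xu≡1+sm) ⟩
    1ℤ + - (x * u)               ≡⟨ lemma₂ x u ⟩
    1ℤ + - u * x                 ∎)
    where
    open ≡-Reasoning
    lemma₁ : ∀ m s → m * - s ≡ 1ℤ + - (1ℤ + s * m)
    lemma₁ = solve-∀
    lemma₂ : ∀ x u → 1ℤ + - (x * u) ≡ 1ℤ + - u * x
    lemma₂ = solve-∀

  *-cancelˡ-≈ : Unit m x → x * y ≈ x * z [ m ] → y ≈ z [ m ]
  *-cancelˡ-≈ {m} {x} {y} {z} (u , xu≈1) xy≈xz = begin
    y             ≡⟨ sym (*-identityˡ y) ⟩
    1ℤ * y        ≈⟨ *-congʳ y xu≈1 ⟨
    x * u * y     ≡⟨ lemma x u y ⟩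
    u * (x * y)   ≈⟨ *-congˡ u xy≈xz ⟩
    u * (x * z)   ≡⟨ sym (lemma x u z) ⟩
    x * u * z     ≈⟨ *-congʳ z xu≈1 ⟩
    1ℤ * z        ≡⟨ *-identityˡ z ⟩
    z             ∎
    where
    open ≈-Reasoning m
    lemma : ∀ x u y → x * u * y ≡ u * (x * y)
    lemma = solve-∀

  ≈-modulus-* : Unit m m′ → x ≈ y [ m ] → x ≈ y [ m′ ] → x ≈ y [ m * m′ ]
  ≈-modulus-* {m} {m′} {x} {y} (u , congruent w m′u≡1+wm) (congruent s eqₛ) (congruent t eqₜ) =
    congruent (s * u - t * w) (begin
      x                                                    ≡⟨ lemma₁ x y w m ⟩
      y + ((x - y) * (1ℤ + w * m) - (x - y) * (w * m))     ≡⟨ cong (λ a → y + ((x - y) * a - (x - y) * (w * m))) m′u≡1+wm ⟨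
      y + ((x - y) * (m′ * u) - (x - y) * (w * m))         ≡⟨ cong₂ (λ a b → y + ((a - y) * (m′ * u) - (b - y) * (w * m))) eqₛ eqₜ ⟩
      y + ((y + s * m - y) * (m′ * u) - (y + t * m′ - y) * (w * m)) ≡⟨ lemma₂ y s t m m′ u w ⟩
      y + (s * u - t * w) * (m * m′)                       ∎)
    where
    open ≡-Reasoning
    lemma₁ : ∀ x y w m → x ≡ y + ((x - y) * (1ℤ + w * m) - (x - y) * (w * m))
    lemma₁ = solve-∀
    lemma₂ : ∀ y s t m m′ u w → y + ((y + s * m - y) * (m′ * u) - (y + t * m′ - y) * (w * m))
                              ≡ y + (s * u - t * w) * (m * m′)
    lemma₂ = solve-∀

  chinese-remainder : Unit m m′ → ∀ a b → ∃ λ x → x ≈ a [ m ] × x ≈ b [ m′ ]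
  chinese-remainder {m} {m′} (u , m′u≈1) a b =
    b + m′ * u * (a - b) ,
    ≈-trans (+-congˡ b (*-congʳ (a - b) m′u≈1)) (≡⇒≈ (lemma₁ a b)) ,
    congruent (u * (a - b)) (lemma₂ a b m′ u)
    where
    lemma₁ : ∀ a b → b + 1ℤ * (a - b) ≡ a
    lemma₁ = solve-∀
    lemma₂ : ∀ a b m′ u → b + m′ * u * (a - b) ≡ b + u * (a - b) * m′
    lemma₂ = solve-∀

  unit⇒coprime : ∀ {n} → Unit (+ n) x → Coprime ∣ x ∣ n
  unit⇒coprime {x} {n} (u , congruent s xu≡1+sn) {d} (d∣x , d∣n) = ℕ.∣1⇒≡1 (≈0⇒∣ {1ℤ} {+ d} (begin
    1ℤ                         ≡⟨ lemma₁ s (+ n) ⟩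
    1ℤ + s * + n - s * + n     ≡⟨ cong (_- s * + n) (sym xu≡1+sn) ⟩
    x * u - s * + n            ≈⟨ +-cong (*-congʳ u (∣⇒≈0 {+ d} {x} d∣x)) (neg-cong (*-congˡ s (∣⇒≈0 {+ d} {+ n} d∣n))) ⟩
    0ℤ * u - s * 0ℤ            ≡⟨ lemma₂ u s ⟩
    0ℤ                         ∎))
    where
    open ≈-Reasoning (+ d)
    lemma₁ : ∀ s n → 1ℤ ≡ 1ℤ + s * n - s * n
    lemma₁ = solve-∀
    lemma₂ : ∀ u s → 0ℤ * u - s * 0ℤ ≡ 0ℤ
    lemma₂ = solve-∀

  coprime⇒unit⁺ : ∀ {k n} → Coprime k n → Unit (+ n) (+ k)
  coprime⇒unit⁺ {k} {n} k⊥n with coprime-Bézout k⊥n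
  ... | Bézout.+- a b eq = + a , congruent (+ b) (begin
    + k * + a              ≡⟨ *-comm (+ k) (+ a) ⟩
    + a * + k              ≡⟨ sym (pos-* a k) ⟩
    + (a ℕ.* k)            ≡⟨ cong +_ (sym eq) ⟩
    + (1 ℕ.+ b ℕ.* n)      ≡⟨ cong (_+_ 1ℤ) (pos-* b n) ⟩
    1ℤ + + b * + n         ∎)
    where open ≡-Reasoning
  ... | Bézout.-+ a b eq = - + a , congruent (- + b) (begin
    + k * - + a                   ≡⟨ lemma₁ (+ k) (+ a) ⟩
    1ℤ + - (1ℤ + + a * + k)       ≡⟨ cong (λ c → 1ℤ + - (1ℤ + c)) (sym (pos-* a k)) ⟩
    1ℤ + - (1ℤ + + (a ℕ.* k))     ≡⟨⟩
    1ℤ + - (+ (1 ℕ.+ a ℕ.* k))    ≡⟨ cong (λ c → 1ℤ + - (+ c)) eq ⟩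
    1ℤ + - (+ (b ℕ.* n))          ≡⟨ cong (λ c → 1ℤ + - c) (pos-* b n) ⟩
    1ℤ + - (+ b * + n)            ≡⟨ lemma₂ (+ b) (+ n) ⟩
    1ℤ + - + b * + n              ∎)
    where
    open ≡-Reasoning
    lemma₁ : ∀ k a → k * - a ≡ 1ℤ + - (1ℤ + a * k)
    lemma₁ = solve-∀
    lemma₂ : ∀ b n → 1ℤ + - (b * n) ≡ 1ℤ + - b * n
    lemma₂ = solve-∀

  coprime⇒unit : ∀ {n} → Coprime ∣ x ∣ n → Unit (+ n) x
  coprime⇒unit {+ k}       {n} x⊥n = coprime⇒unit⁺ {k} {n} x⊥n
  coprime⇒unit { -[1+ k ]} {n} x⊥n = unit-neg (coprime⇒unit⁺ {suc k} {n} x⊥n)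

  -≈0⇒≈ : x - y ≈ 0ℤ [ m ] → x ≈ y [ m ]
  -≈0⇒≈ {x} {y} {m} (congruent s eq) = congruent s (trans (lemma x y) (cong (_+_ y) (trans eq (lemma′ (s * m)))))
    where
    lemma : ∀ x y → x ≡ y + (x - y)
    lemma = solve-∀
    lemma′ : ∀ a → 0ℤ + a ≡ a
    lemma′ = solve-∀

  ≈-pos-*⁺ : ∀ a b → x ≈ y [ + a * + b ] → x ≈ y [ + (a ℕ.* b) ]
  ≈-pos-*⁺ {x} {y} a b = subst (x ≈ y [_]) (sym (pos-* a b))

  ≈-pos-*⁻ : ∀ a b → x ≈ y [ + (a ℕ.* b) ] → x ≈ y [ + a * + b ]
  ≈-pos-*⁻ {x} {y} a b = subst (x ≈ y [_]) (pos-* a b)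

module MultiplicativeOrder where
  open import Data.Integer using (_*_; _^_)
  open Congruence

  private variable
    g h m x y : ℤ
    i j k n M N : ℕ

  ≡+*⇒≈ : ∀ q → i ≡ j ℕ.+ q ℕ.* n → + i ≈ + j [ + n ]
  ≡+*⇒≈ {j = j} {n} q refl = congruent (+ q) (trans (pos-+ j (q ℕ.* n)) (cong (_+_ (+ j)) (pos-* q n)))

  ∣∸⇒≈ : i ℕ.≤ j → n ℕ.∣ j ℕ.∸ i → + i ≈ + j [ + n ]
  ∣∸⇒≈ {i} i≤j (ℕ.divides q j∸i≡qn) =
    ≈-sym (≡+*⇒≈ q (trans (sym (ℕ.m+[n∸m]≡n i≤j)) (cong (i ℕ.+_) j∸i≡qn)))

  ≈⇒≡+* : + i ≈ + j [ + n ] → (∃ λ q → i ≡ j ℕ.+ q ℕ.* n) ⊎ (∃ λ q → j ≡ i ℕ.+ q ℕ.* n)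
  ≈⇒≡+* {i} {j} {n} (congruent (+ q) i≡j+qn) = inj₁ (q , +-injective
    (trans i≡j+qn (trans (cong (_+_ (+ j)) (sym (pos-* q n))) (sym (pos-+ j (q ℕ.* n))))))
  ≈⇒≡+* {i} {j} {n} (congruent -[1+ q ] i≡j-qn) = inj₂ (suc q , +-injective
    (trans (lemma (+ j) (+ suc q) (+ n)) (trans (cong₂ _+_ (sym i≡j-qn) (sym (pos-* (suc q) n)))
      (sym (pos-+ i (suc q ℕ.* n))))))
    where
    lemma : ∀ j q n → j ≡ j + - q * n + q * n
    lemma = solve-∀

  <∧≈⇒≡ : .{{_ : NonZero n}} → i ℕ.< n → j ℕ.< n → + i ≈ + j [ + n ] → i ≡ j
  <∧≈⇒≡ {n} {i} {j} i<n j<n i≈j with ≈⇒≡+* i≈j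
  ... | inj₁ (q , i≡j+qn) = trans (sym (ℕ.m<n⇒m%n≡m i<n))
    (trans (cong (ℕ._% n) i≡j+qn) (trans (ℕ.[m+kn]%n≡m%n j q n) (ℕ.m<n⇒m%n≡m j<n)))
  ... | inj₂ (q , j≡i+qn) = sym (trans (sym (ℕ.m<n⇒m%n≡m j<n))
    (trans (cong (ℕ._% n) j≡i+qn) (trans (ℕ.[m+kn]%n≡m%n i q n) (ℕ.m<n⇒m%n≡m i<n))))

  1≉0 : 1 ℕ.< n → ¬ 1ℤ ≈ 0ℤ [ + n ]
  1≉0 {n} 1<n 1≈0 = ℕ.<⇒≢ 1<n (sym (ℕ.∣1⇒≡1 (≈0⇒∣ 1≈0)))

  unit⇒≉0 : 1 ℕ.< n → Unit (+ n) x → ¬ x ≈ 0ℤ [ + n ]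
  unit⇒≉0 1<n (u , xu≈1) x≈0 = 1≉0 1<n (≈-trans (≈-sym xu≈1) (*-congʳ u x≈0))

  residue : ∀ n .{{_ : NonZero n}} → ℤ → Fin n
  residue n x = fromℕ< (n%ℕd<d x n)

  residue-injective : .{{_ : NonZero n}} → residue n x ≡ residue n y → x ≈ y [ + n ]
  residue-injective {n} {x} {y} eq = ≈-trans (%ℕ-≈ x n)
    (≈-trans (≡⇒≈ (cong +_ (Fin.fromℕ<-injective _ _ (n%ℕd<d x n) (n%ℕd<d y n) eq))) (≈-sym (%ℕ-≈ y n)))

  ^-+-multiple : g ^ N ≈ 1ℤ [ m ] → ∀ j q → g ^ (j ℕ.+ q ℕ.* N) ≈ g ^ j [ m ]
  ^-+-multiple {g} {N} {m} g^N≈1 j q = begin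
    g ^ (j ℕ.+ q ℕ.* N)      ≡⟨ ^-distribˡ-+-* g j (q ℕ.* N) ⟩
    g ^ j * g ^ (q ℕ.* N)    ≡⟨ cong (λ e → g ^ j * g ^ e) (ℕ.*-comm q N) ⟩
    g ^ j * g ^ (N ℕ.* q)    ≡⟨ cong (g ^ j *_) (sym (^-*-assoc g N q)) ⟩
    g ^ j * (g ^ N) ^ q      ≈⟨ *-congˡ (g ^ j) (≈1⇒^≈1 q g^N≈1) ⟩
    g ^ j * 1ℤ               ≡⟨ *-identityʳ (g ^ j) ⟩
    g ^ j                    ∎
    where open ≈-Reasoning m

  ^-exponent-cong : g ^ N ≈ 1ℤ [ m ] → + i ≈ + j [ + N ] → g ^ i ≈ g ^ j [ m ]
  ^-exponent-cong {g} {N} {i = i} {j} g^N≈1 i≈j with ≈⇒≡+* i≈j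
  ... | inj₁ (q , refl) = ^-+-multiple {g} {N} g^N≈1 j q
  ... | inj₂ (q , refl) = ≈-sym (^-+-multiple {g} {N} g^N≈1 i q)

  record Order (m g : ℤ) (N : ℕ) : Set where
    field
      nonZero  : NonZero N
      ^≈1      : g ^ N ≈ 1ℤ [ m ]
      ^≈1⇒∣    : ∀ k → g ^ k ≈ 1ℤ [ m ] → N ℕ.∣ k

  ^≈1⇒unit : .{{_ : NonZero N}} → g ^ N ≈ 1ℤ [ m ] → Unit m g
  ^≈1⇒unit {suc N} {g} g^N≈1 = g ^ N , g^N≈1

  module _ (ord : Order m g N) where
    open Order ord

    order⇒unit : Unit m g
    order⇒unit = ^≈1⇒unit {N} {g} {{nonZero}} ^≈1

    order⇒exponent-cong : + i ≈ + j [ + N ] → g ^ i ≈ g ^ j [ m ]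
    order⇒exponent-cong = ^-exponent-cong {g} {N} ^≈1

    private
      ≤⇒exponent-≈ : i ℕ.≤ j → g ^ i ≈ g ^ j [ m ] → + i ≈ + j [ + N ]
      ≤⇒exponent-≈ {i} {j} i≤j g^i≈g^j = ∣∸⇒≈ i≤j (^≈1⇒∣ (j ℕ.∸ i) (≈-sym (*-cancelˡ-≈ (unit-^ i order⇒unit) (begin
        g ^ i * 1ℤ                 ≡⟨ *-identityʳ (g ^ i) ⟩
        g ^ i                      ≈⟨ g^i≈g^j ⟩
        g ^ j                      ≡⟨ cong (g ^_) (sym (ℕ.m+[n∸m]≡n i≤j)) ⟩
        g ^ (i ℕ.+ (j ℕ.∸ i))      ≡⟨ ^-distribˡ-+-* g i (j ℕ.∸ i) ⟩
        g ^ i * g ^ (j ℕ.∸ i)      ∎))))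
        where open ≈-Reasoning m

    order⇒exponent-≈ : ∀ i j → g ^ i ≈ g ^ j [ m ] → + i ≈ + j [ + N ]
    order⇒exponent-≈ i j g^i≈g^j with ℕ.≤-total i j
    ... | inj₁ i≤j = ≤⇒exponent-≈ i≤j g^i≈g^j
    ... | inj₂ j≤i = ≈-sym (≤⇒exponent-≈ j≤i (≈-sym g^i≈g^j))

  order∣⇒^≈1 : Order m g N → N ℕ.∣ k → g ^ k ≈ 1ℤ [ m ]
  order∣⇒^≈1 {g = g} {N} ord (ℕ.divides q refl) = ^-+-multiple {g} {N} (Order.^≈1 ord) 0 q

  least : ∀ {P : ℕ → Set} → Decidable P → ∀ n → P n → ∃ λ k → P k × (∀ {j} → j ℕ.< k → ¬ P j)
  least {P} P? = <-rec _ step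
    where
    step : ∀ n → (∀ {j} → j ℕ.< n → P j → ∃ λ k → P k × (∀ {j} → j ℕ.< k → ¬ P j)) →
           P n → ∃ λ k → P k × (∀ {j} → j ℕ.< k → ¬ P j)
    step n rec Pn with ℕ.anyUpTo? P? n
    ... | yes (j , j<n , Pj) = rec j<n Pj
    ... | no ¬∃ = n , Pn , λ j<n Pj → ¬∃ (_ , j<n , Pj)

  finite-order : .{{_ : NonZero n}} → Unit (+ n) x → ∃ (Order (+ n) x)
  finite-order {n} {x} ux with Fin.pigeonhole (ℕ.n<1+n n) (λ i → residue n (x ^ toℕ i))
  ... | i , j , i<j , eq with least (λ k → (1 ℕ.≤? k) ×-dec (x ^ k ≈? 1ℤ [ + n ])) (toℕ j ℕ.∸ toℕ i)
                                (ℕ.m<n⇒0<n∸m i<j , x^[j-i]≈1)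
    where
    open ≈-Reasoning (+ n)
    x^[j-i]≈1 : x ^ (toℕ j ℕ.∸ toℕ i) ≈ 1ℤ [ + n ]
    x^[j-i]≈1 = *-cancelˡ-≈ (unit-^ (toℕ i) ux) (begin
      x ^ toℕ i * x ^ (toℕ j ℕ.∸ toℕ i)    ≡⟨ sym (^-distribˡ-+-* x (toℕ i) (toℕ j ℕ.∸ toℕ i)) ⟩
      x ^ (toℕ i ℕ.+ (toℕ j ℕ.∸ toℕ i))    ≡⟨ cong (x ^_) (ℕ.m+[n∸m]≡n (ℕ.<⇒≤ i<j)) ⟩
      x ^ toℕ j                            ≈⟨ residue-injective eq ⟨
      x ^ toℕ i                            ≡⟨ sym (*-identityʳ (x ^ toℕ i)) ⟩
      x ^ toℕ i * 1ℤ                       ∎)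
  ... | N@(suc _) , (_ , x^N≈1) , minimal = N , record
    { nonZero = _ ; ^≈1 = x^N≈1 ; ^≈1⇒∣ = λ k x^k≈1 → ℕ.m%n≡0⇒n∣m k N (remainder k x^k≈1) }
    where
    remainder : ∀ k → x ^ k ≈ 1ℤ [ + n ] → k ℕ.% N ≡ 0
    remainder k x^k≈1 with k ℕ.% N in eq | ℕ.m%n<n k N | ℕ.m≡m%n+[m/n]*n k N
    ... | zero  | _   | _ = refl
    ... | suc r | r<N | k≡ = contradiction
      (ℕ.s≤s ℕ.z≤n , ≈-trans (^-exponent-cong {x} {N} x^N≈1 (≈-sym (≡+*⇒≈ (k ℕ./ N) k≡))) x^k≈1)
      (minimal r<N)

  order-^ : ∀ r → Order m g (r ℕ.* N) → Order m (g ^ r) N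
  order-^ {m} {g} {N} r ord = record
    { nonZero = ℕ.m*n≢0⇒n≢0 r {{Order.nonZero ord}}
    ; ^≈1 = ≈-trans (≡⇒≈ (^-*-assoc g r N)) (Order.^≈1 ord)
    ; ^≈1⇒∣ = λ k g^rk≈1 → ℕ.*-cancelˡ-∣ r {{ℕ.m*n≢0⇒m≢0 r {{Order.nonZero ord}}}}
        (Order.^≈1⇒∣ ord (r ℕ.* k) (≈-trans (≡⇒≈ (sym (^-*-assoc g r k))) g^rk≈1))
    }

  coprime-*-∣ : Coprime M N → M ℕ.∣ k → N ℕ.∣ k → M ℕ.* N ℕ.∣ k
  coprime-*-∣ {M} {N} M⊥N (ℕ.divides q refl) N∣qM =
    subst (ℕ._∣ q ℕ.* M) (ℕ.*-comm N M) (ℕ.*-monoˡ-∣ M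
      (coprime-divisor (Coprimality.sym M⊥N) (subst (N ℕ.∣_) (ℕ.*-comm q M) N∣qM)))

  order-* : Coprime M N → Order m g M → Order m h N → Order m (g * h) (M ℕ.* N)
  order-* {M} {N} {m} {g} {h} M⊥N og oh = record
    { nonZero = ℕ.m*n≢0 M N {{Order.nonZero og}} {{Order.nonZero oh}}
    ; ^≈1 = begin
        (g * h) ^ (M ℕ.* N)               ≡⟨ ^-distribʳ-* g h (M ℕ.* N) ⟩
        g ^ (M ℕ.* N) * h ^ (M ℕ.* N)     ≈⟨ *-cong (order∣⇒^≈1 og (ℕ.m∣m*n N)) (order∣⇒^≈1 oh (ℕ.n∣m*n M)) ⟩
        1ℤ                                ∎
    ; ^≈1⇒∣ = λ k gh^k≈1 → coprime-*-∣ M⊥N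
        (coprime-divisor M⊥N (Order.^≈1⇒∣ og (N ℕ.* k) (begin
          g ^ (N ℕ.* k)                        ≡⟨ sym (*-identityʳ _) ⟩
          g ^ (N ℕ.* k) * 1ℤ                   ≈⟨ *-congˡ (g ^ (N ℕ.* k)) (order∣⇒^≈1 oh (ℕ.m∣m*n k)) ⟨
          g ^ (N ℕ.* k) * h ^ (N ℕ.* k)        ≈⟨ both N k gh^k≈1 ⟩
          1ℤ                                   ∎)))
        (coprime-divisor (Coprimality.sym M⊥N) (Order.^≈1⇒∣ oh (M ℕ.* k) (begin
          h ^ (M ℕ.* k)                        ≡⟨ sym (*-identityˡ _) ⟩
          1ℤ * h ^ (M ℕ.* k)                   ≈⟨ *-congʳ (h ^ (M ℕ.* k)) (order∣⇒^≈1 og (ℕ.m∣m*n k)) ⟨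
          g ^ (M ℕ.* k) * h ^ (M ℕ.* k)        ≈⟨ both M k gh^k≈1 ⟩
          1ℤ                                   ∎)))
    }
    where
    open ≈-Reasoning m
    both : ∀ N k → (g * h) ^ k ≈ 1ℤ [ m ] → g ^ (N ℕ.* k) * h ^ (N ℕ.* k) ≈ 1ℤ [ m ]
    both N k gh^k≈1 = begin
      g ^ (N ℕ.* k) * h ^ (N ℕ.* k)   ≡⟨ sym (^-distribʳ-* g h (N ℕ.* k)) ⟩
      (g * h) ^ (N ℕ.* k)             ≡⟨ cong ((g * h) ^_) (ℕ.*-comm N k) ⟩
      (g * h) ^ (k ℕ.* N)             ≡⟨ sym (^-*-assoc (g * h) k N) ⟩
      ((g * h) ^ k) ^ N               ≈⟨ ≈1⇒^≈1 N gh^k≈1 ⟩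
      1ℤ                              ∎

  order-< : 1 ℕ.< n → Order (+ n) g N → N ℕ.< n
  order-< {n} {g} {N} 1<n ord = Fin.injective⇒≤ {f = residue n ∘ F} (inj _ _ ∘ residue-injective)
    where
    instance _ = ℕ.>-nonZero (ℕ.<-trans (ℕ.s≤s ℕ.z≤n) 1<n)
    instance _ = Order.nonZero ord
    F : Fin (suc N) → ℤ
    F Fin.zero    = 0ℤ
    F (Fin.suc i) = g ^ toℕ i
    g^≉0 : ∀ i → ¬ g ^ i ≈ 0ℤ [ + n ]
    g^≉0 i = unit⇒≉0 1<n (unit-^ i (order⇒unit ord))
    inj : ∀ i j → F i ≈ F j [ + n ] → i ≡ j
    inj Fin.zero    Fin.zero    _  = refl
    inj Fin.zero    (Fin.suc j) eq = contradiction (≈-sym eq) (g^≉0 (toℕ j))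
    inj (Fin.suc i) Fin.zero    eq = contradiction eq (g^≉0 (toℕ i))
    inj (Fin.suc i) (Fin.suc j) eq = cong Fin.suc (Fin.toℕ-injective
      (<∧≈⇒≡ (Fin.toℕ<n i) (Fin.toℕ<n j) (order⇒exponent-≈ ord (toℕ i) (toℕ j) eq)))

module PrimeDivisors where
  open import Data.Integer using (_*_; _^_)
  open Congruence
  open MultiplicativeOrder

  private variable
    x y : ℤ
    a b i j k m n p q r M N : ℕ

  prime⇒1< : Prime p → 1 ℕ.< p
  prime⇒1< pp = ℕ.nonTrivial⇒n>1 _ {{prime⇒nonTrivial pp}}

  prime∤⇒coprime : Prime p → ¬ p ℕ.∣ n → Coprime p n
  prime∤⇒coprime pp p∤n {d} (d∣p , d∣n) with prime⇒irreducible pp d∣p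
  ... | inj₁ d≡1  = d≡1
  ... | inj₂ refl = contradiction d∣n p∤n

  prime∧≉0⇒unit : Prime p → ¬ x ≈ 0ℤ [ + p ] → Unit (+ p) x
  prime∧≉0⇒unit {p} {x} pp x≉0 = coprime⇒unit {x} {p} (Coprimality.sym
    (prime∤⇒coprime pp λ p∣x → x≉0 (∣⇒≈0 {+ p} {x} p∣x)))

  euclid-≈ : Prime p → x * y ≈ 0ℤ [ + p ] → x ≈ 0ℤ [ + p ] ⊎ y ≈ 0ℤ [ + p ]
  euclid-≈ {p} {x} {y} pp xy≈0 with euclidsLemma ∣ x ∣ ∣ y ∣ pp (subst (p ℕ.∣_) (abs-* x y) (≈0⇒∣ xy≈0))
  ... | inj₁ p∣x = inj₁ (∣⇒≈0 {+ p} {x} p∣x)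
  ... | inj₂ p∣y = inj₂ (∣⇒≈0 {+ p} {y} p∣y)

  pos-^ : ∀ n k → + (n ℕ.^ k) ≡ (+ n) ^ k
  pos-^ n zero    = refl
  pos-^ n (suc k) = trans (pos-* n (n ℕ.^ k)) (cong (+ n *_) (pos-^ n k))

  coprime-^ˡ : ∀ k → Coprime M N → Coprime (M ℕ.^ k) N
  coprime-^ˡ {M} {N} k M⊥N = unit⇒coprime {+ (M ℕ.^ k)} {N}
    (subst (Unit (+ N)) (sym (pos-^ M k)) (unit-^ k (coprime⇒unit {+ M} {N} M⊥N)))

  prime-factor : 1 ℕ.< n → ∃ λ p → Prime p × p ℕ.∣ n
  prime-factor {n} 1<n with factorise n {{ℕ.>-nonZero (ℕ.<-trans (ℕ.s≤s ℕ.z≤n) 1<n)}}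
  ... | record { factors = [] ; isFactorisation = n≡1 } = contradiction (sym n≡1) (ℕ.<⇒≢ 1<n)
  ... | record { factors = p ∷ ps ; isFactorisation = n≡p*ps ; factorsPrime = pp ∷ _ } =
    p , pp , subst (p ℕ.∣_) (sym n≡p*ps) (ℕ.m∣m*n _)

  split-prime : Prime r → ∀ n → .{{NonZero n}} → ∃ λ e → ∃ λ m → n ≡ r ℕ.^ e ℕ.* m × ¬ r ℕ.∣ m
  split-prime {r} pr = <-rec _ step
    where
    step : ∀ n → (∀ {m} → m ℕ.< n → .{{NonZero m}} → ∃ λ e → ∃ λ m′ → m ≡ r ℕ.^ e ℕ.* m′ × ¬ r ℕ.∣ m′) →
           .{{NonZero n}} → ∃ λ e → ∃ λ m → n ≡ r ℕ.^ e ℕ.* m × ¬ r ℕ.∣ m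
    step n rec with r ℕ.∣? n
    ... | no r∤n = 0 , n , sym (ℕ.*-identityˡ n) , r∤n
    ... | yes (ℕ.divides q n≡qr) with rec {q} q<n {{q≢0}}
      where
      n≢0 : NonZero (q ℕ.* r)
      n≢0 = subst NonZero n≡qr (ℕ.≢-nonZero (ℕ.≢-nonZero⁻¹ n))
      q≢0 : NonZero q
      q≢0 = ℕ.m*n≢0⇒m≢0 q {{n≢0}}
      q<n : q ℕ.< n
      q<n = subst (q ℕ.<_) (sym n≡qr) (ℕ.m<m*n q r {{q≢0}} (prime⇒1< pr))
    ...   | e , m , q≡r^e*m , r∤m = suc e , m ,
      trans n≡qr (trans (ℕ.*-comm q r) (trans (cong (r ℕ.*_) q≡r^e*m) (sym (ℕ.*-assoc r (r ℕ.^ e) m)))) , r∤m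

  ^-monoʳ-∣ : ∀ r → i ℕ.≤ j → r ℕ.^ i ℕ.∣ r ℕ.^ j
  ^-monoʳ-∣ {i} {j} r i≤j = subst (r ℕ.^ i ℕ.∣_)
    (trans (sym (ℕ.^-distribˡ-+-* r i (j ℕ.∸ i))) (cong (r ℕ.^_) (ℕ.m+[n∸m]≡n i≤j))) (ℕ.m∣m*n (r ℕ.^ (j ℕ.∸ i)))

  Excess : ℕ → ℕ → Set
  Excess k m = ∃ λ r → ∃ λ f → ∃ λ k′ → ∃ λ m′ →
    Prime r × k ≡ r ℕ.^ suc f ℕ.* k′ × m ≡ r ℕ.^ f ℕ.* m′ × ¬ r ℕ.∣ m′

  excess-* : ∀ c → Excess k M → Excess (c ℕ.* k) M
  excess-* c (r , f , k′ , m′ , pr , refl , rest) =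
    r , f , c ℕ.* k′ , m′ , pr , swap c (r ℕ.^ suc f) k′ , rest
    where
    swap : ∀ a b c → a ℕ.* (b ℕ.* c) ≡ b ℕ.* (a ℕ.* c)
    swap a b c = trans (sym (ℕ.*-assoc a b c)) (trans (cong (ℕ._* c) (ℕ.*-comm a b)) (ℕ.*-assoc b a c))

  ∤⇒excess : ∀ m .{{_ : NonZero m}} k → NonZero k → ¬ k ℕ.∣ m → Excess k m
  ∤⇒excess m = <-rec _ step
    where
    1<k : ∀ {k} → NonZero k → ¬ k ℕ.∣ m → 1 ℕ.< k
    1<k {k} k≢0 k∤m = ℕ.≤∧≢⇒< (ℕ.>-nonZero⁻¹ k {{k≢0}}) λ { refl → k∤m (ℕ.1∣ m) }
    step : ∀ k → (∀ {j} → j ℕ.< k → NonZero j → ¬ j ℕ.∣ m → Excess j m) →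
           NonZero k → ¬ k ℕ.∣ m → Excess k m
    step k rec k≢0 k∤m = split (prime-factor (1<k k≢0 k∤m))
      where
      split : (∃ λ r → Prime r × r ℕ.∣ k) → Excess k m
      split (r , pr , r∣k) = compare (split-prime pr k {{k≢0}}) (split-prime pr m)
        where
        compare : (∃ λ e → ∃ λ k′ → k ≡ r ℕ.^ e ℕ.* k′ × ¬ r ℕ.∣ k′) →
                  (∃ λ f → ∃ λ m′ → m ≡ r ℕ.^ f ℕ.* m′ × ¬ r ℕ.∣ m′) → Excess k m
        compare (e , k′ , k≡ , r∤k′) (f , m′ , m≡ , r∤m′) = decide (e ℕ.≤? f)
          where
          decide : Dec (e ℕ.≤ f) → Excess k m
          decide (no e≰f) = r , f , r ℕ.^ (e ℕ.∸ suc f) ℕ.* k′ , m′ , pr ,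
            trans k≡ (trans (cong (ℕ._* k′) r^e≡) (ℕ.*-assoc (r ℕ.^ suc f) _ k′)) , m≡ , r∤m′
            where
            r^e≡ : r ℕ.^ e ≡ r ℕ.^ suc f ℕ.* r ℕ.^ (e ℕ.∸ suc f)
            r^e≡ = trans (cong (r ℕ.^_) (sym (ℕ.m+[n∸m]≡n (ℕ.≰⇒> e≰f)))) (ℕ.^-distribˡ-+-* r (suc f) (e ℕ.∸ suc f))
          decide (yes e≤f) = subst (λ k → Excess k m) (sym k≡) (excess-* (r ℕ.^ e) (rec k′<k k′≢0 k′∤m))
            where
            k′≢0 : NonZero k′
            k′≢0 = ℕ.m*n≢0⇒n≢0 (r ℕ.^ e) {{subst NonZero k≡ k≢0}}
            k′≢k : k′ ≢ k
            k′≢k refl = r∤k′ r∣k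
            k′<k : k′ ℕ.< k
            k′<k = ℕ.≤∧≢⇒< (ℕ.∣⇒≤ {{k≢0}} (subst (k′ ℕ.∣_) (sym k≡) (ℕ.n∣m*n (r ℕ.^ e)))) k′≢k
            k′∤m : ¬ k′ ℕ.∣ m
            k′∤m k′∣m = k∤m (subst (ℕ._∣ m) (sym k≡) (coprime-*-∣
              (coprime-^ˡ {r} {k′} e (prime∤⇒coprime pr r∤k′))
              (subst (r ℕ.^ e ℕ.∣_) (sym m≡) (ℕ.∣-trans (^-monoʳ-∣ r e≤f) (ℕ.m∣m*n m′))) k′∣m))

  prime∣⇒≡ : Prime p → Prime q → p ℕ.∣ q → p ≡ q
  prime∣⇒≡ pp pq p∣q = [ (λ p≡1 → contradiction (sym p≡1) (ℕ.<⇒≢ (prime⇒1< pp))) , id ]′ (prime⇒irreducible pq p∣q)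

  1<p^ : Prime p → ∀ α → 1 ℕ.< p ℕ.^ suc α
  1<p^ {p} pp α = ℕ.^-monoʳ-< p (prime⇒1< pp) {0} {suc α} (ℕ.s≤s ℕ.z≤n)

  prime-power-unit : ∀ α → Prime p → ¬ p ℕ.∣ m → Unit (+ (p ℕ.^ α)) (+ m)
  prime-power-unit {p} {m} α pp p∤m = unit-sym (coprime⇒unit {+ (p ℕ.^ α)} {m} (coprime-^ˡ {p} {m} α (prime∤⇒coprime pp p∤m)))

  PrimePowerFactor : ℕ → Set
  PrimePowerFactor n = ∃ λ p → ∃ λ α → ∃ λ m → Prime p × n ≡ p ℕ.^ suc α ℕ.* m × ¬ p ℕ.∣ m

  prime-power-factor : 1 ℕ.< n → PrimePowerFactor n
  prime-power-factor {n} 1<n = split (prime-factor 1<n)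
    where
    split : (∃ λ p → Prime p × p ℕ.∣ n) → PrimePowerFactor n
    split (p , pp , p∣n) = check (split-prime pp n {{ℕ.>-nonZero (ℕ.<-trans (ℕ.s≤s ℕ.z≤n) 1<n)}})
      where
      check : (∃ λ e → ∃ λ m → n ≡ p ℕ.^ e ℕ.* m × ¬ p ℕ.∣ m) → PrimePowerFactor n
      check (zero  , m , n≡ , p∤m) = contradiction (subst (p ℕ.∣_) (trans n≡ (ℕ.*-identityˡ m)) p∣n) p∤m
      check (suc α , m , n≡ , p∤m) = p , α , m , pp , n≡ , p∤m

  2∣n⊎2∣1+n : ∀ n → 2 ℕ.∣ n ⊎ 2 ℕ.∣ suc n
  2∣n⊎2∣1+n zero = inj₁ (2 ℕ.∣0)
  2∣n⊎2∣1+n (suc n) = [ (λ 2∣n → inj₂ (ℕ.∣m∣n⇒∣m+n ℕ.∣-refl 2∣n)) , inj₁ ]′ (2∣n⊎2∣1+n n)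

  2∤⇒2∣1+ : ¬ 2 ℕ.∣ n → 2 ℕ.∣ suc n
  2∤⇒2∣1+ {n} 2∤n = [ (λ 2∣n → contradiction 2∣n 2∤n) , id ]′ (2∣n⊎2∣1+n n)

  odd+odd : ¬ 2 ℕ.∣ i → ¬ 2 ℕ.∣ j → 2 ℕ.∣ i ℕ.+ j
  odd+odd {i} {j} 2∤i 2∤j = ℕ.∣m+n∣m⇒∣n {n = i ℕ.+ j}
    (subst (2 ℕ.∣_) (cong suc (ℕ.+-suc i j)) (ℕ.∣m∣n⇒∣m+n (2∤⇒2∣1+ 2∤i) (2∤⇒2∣1+ 2∤j))) (ℕ.∣-refl {2})

  2∤⇒2∤^ : ∀ α → ¬ 2 ℕ.∣ p → ¬ 2 ℕ.∣ p ℕ.^ α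
  2∤⇒2∤^ zero    2∤p 2∣1  = contradiction (ℕ.∣1⇒≡1 2∣1) λ ()
  2∤⇒2∤^ {p} (suc α) 2∤p 2∣p^ = 2∤⇒2∤^ α 2∤p (coprime-divisor (prime∤⇒coprime prime[2] 2∤p) 2∣p^)

  2∤*⇒2∤ˡ : ∀ b → ¬ 2 ℕ.∣ a ℕ.* b → ¬ 2 ℕ.∣ a
  2∤*⇒2∤ˡ b 2∤ab 2∣a = 2∤ab (ℕ.∣m⇒∣m*n b 2∣a)

  2∤*⇒2∤ʳ : ∀ a → ¬ 2 ℕ.∣ a ℕ.* b → ¬ 2 ℕ.∣ b
  2∤*⇒2∤ʳ a 2∤ab 2∣b = 2∤ab (ℕ.∣n⇒∣m*n a 2∣b)

  odd>1 : ¬ 2 ℕ.∣ n → n ≢ 1 → 1 ℕ.< n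
  odd>1 {zero}          2∤0 _   = contradiction (2 ℕ.∣0) 2∤0
  odd>1 {suc zero}      _   1≢1 = contradiction refl 1≢1
  odd>1 {suc (suc _)}   _   _   = ℕ.s≤s (ℕ.s≤s ℕ.z≤n)

module PrimeModulus where
  open import Data.Integer using (_*_; _^_)
  open Congruence
  open MultiplicativeOrder
  open PrimeDivisors

  private variable
    g m x y : ℤ
    k p M N : ℕ

  -- A list c₀ ∷ … ∷ cₖ ∷ [] stands for the monic polynomial c₀ + … + cₖ xᵏ + xᵏ⁺¹.
  eval : List ℤ → ℤ → ℤ
  eval []       x = 1ℤ
  eval (c ∷ cs) x = c + x * eval cs x

  quotient : List ℤ → ℤ → List ℤ
  quotient []            a = []
  quotient (c ∷ [])      a = []
  quotient (c ∷ d ∷ cs)  a = eval (d ∷ cs) a ∷ quotient (d ∷ cs) a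

  length-quotient : ∀ c cs a → length (quotient (c ∷ cs) a) ≡ length cs
  length-quotient c []       a = refl
  length-quotient c (d ∷ cs) a = cong suc (length-quotient d cs a)

  eval-quotient : ∀ c cs a x → eval (c ∷ cs) x ≡ eval (c ∷ cs) a + (x - a) * eval (quotient (c ∷ cs) a) x
  eval-quotient c [] a x = lemma c a x
    where
    lemma : ∀ c a x → c + x * 1ℤ ≡ c + a * 1ℤ + (x - a) * 1ℤ
    lemma = solve-∀
  eval-quotient c (d ∷ cs) a x = trans (cong (λ e → c + x * e) (eval-quotient d cs a x))
    (lemma c a x (eval (d ∷ cs) a) (eval (quotient (d ∷ cs) a) x))
    where
    lemma : ∀ c a x e q → c + x * (e + (x - a) * q) ≡ c + a * e + (x - a) * (e + x * q)
    lemma = solve-∀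

  root-of-quotient : Prime p → ∀ {f a q x} → a ≈ 0ℤ [ + p ] → f ≈ 0ℤ [ + p ] → f ≡ a + (x - y) * q →
                     ¬ y ≈ x [ + p ] → q ≈ 0ℤ [ + p ]
  root-of-quotient {p} {y} pp {f} {a} {q} {x} a≈0 f≈0 f≡ y≉x =
    [ (λ x-y≈0 → contradiction (≈-sym (-≈0⇒≈ x-y≈0)) y≉x) , id ]′ (euclid-≈ {x = x - y} {y = q} pp (begin
      (x - y) * q          ≡⟨ lemma a ((x - y) * q) ⟩
      a + (x - y) * q - a  ≡⟨ cong (_- a) (sym f≡) ⟩
      f - a                ≈⟨ +-cong f≈0 (neg-cong a≈0) ⟩
      0ℤ                   ∎))
    where
    open ≈-Reasoning (+ p)
    lemma : ∀ a b → b ≡ a + b - a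
    lemma = solve-∀

  roots≤degree : Prime p → ∀ cs rs → AllPairs (λ x y → ¬ x ≈ y [ + p ]) rs →
                 All (λ x → eval cs x ≈ 0ℤ [ + p ]) rs → length rs ℕ.≤ length cs
  roots≤degree pp cs       []       _  _  = ℕ.z≤n
  roots≤degree pp []       (r ∷ rs) _  (1≈0 ∷ _) = contradiction 1≈0 (1≉0 (prime⇒1< pp))
  roots≤degree {p} pp (c ∷ cs) (r ∷ rs) (r≉rs ∷ rs≉rs) (f[r]≈0 ∷ f[rs]≈0) = ℕ.s≤s
    (subst (length rs ℕ.≤_) (length-quotient c cs r)
      (roots≤degree pp (quotient (c ∷ cs) r) rs rs≉rs (All.zipWith root (r≉rs , f[rs]≈0))))
    where
    root : ∀ {x} → ¬ r ≈ x [ + p ] × eval (c ∷ cs) x ≈ 0ℤ [ + p ] → eval (quotient (c ∷ cs) r) x ≈ 0ℤ [ + p ]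
    root {x} (r≉x , f[x]≈0) = root-of-quotient {y = r} pp f[r]≈0 f[x]≈0 (eval-quotient c cs r x) r≉x

  eval-replicate : ∀ k x → eval (replicate k 0ℤ) x ≡ x ^ k
  eval-replicate zero    x = refl
  eval-replicate (suc k) x = trans (cong (λ e → 0ℤ + x * e) (eval-replicate k x)) (lemma (x * x ^ k))
    where
    lemma : ∀ x → 0ℤ + x ≡ x
    lemma = solve-∀

  roots-of-unity≤ : Prime p → .{{_ : NonZero k}} → ∀ rs → AllPairs (λ x y → ¬ x ≈ y [ + p ]) rs →
                    All (λ x → x ^ k ≈ 1ℤ [ + p ]) rs → length rs ℕ.≤ k
  roots-of-unity≤ {p} {suc k} pp rs rs≉rs rs^k≈1 =
    subst (λ d → length rs ℕ.≤ suc d) (length-replicate k)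
      (roots≤degree pp (- 1ℤ ∷ replicate k 0ℤ) rs rs≉rs (All.map (λ {x} → root {x}) rs^k≈1))
    where
    root : ∀ {x} → x ^ suc k ≈ 1ℤ [ + p ] → eval (- 1ℤ ∷ replicate k 0ℤ) x ≈ 0ℤ [ + p ]
    root {x} x^k≈1 = ≈-trans (≡⇒≈ (cong (λ e → - 1ℤ + x * e) (eval-replicate k x))) (+-congˡ (- 1ℤ) x^k≈1)

  -- With M = rᶠ M′ and N = rᶠ⁺¹ N′, the elements g^(rᶠ) and x^(N′) have the coprime orders M′ and rᶠ⁺¹.
  larger-order : Order m g M → Order m x N → ¬ N ℕ.∣ M → ∃ λ y → ∃ λ L → M ℕ.< L × Order m y L
  larger-order {m} {g} {M} {x} {N} og ox N∤M
    with ∤⇒excess M {{Order.nonZero og}} N (Order.nonZero ox) N∤M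
  ... | r , f , N′ , M′ , pr , refl , refl , r∤M′ =
    x ^ N′ * g ^ (r ℕ.^ f) , r ℕ.^ suc f ℕ.* M′ ,
    ℕ.*-monoˡ-< M′ {{ℕ.m*n≢0⇒n≢0 (r ℕ.^ f) {{Order.nonZero og}}}} (ℕ.^-monoʳ-< r (prime⇒1< pr) (ℕ.n<1+n f)) ,
    order-* (coprime-^ˡ {r} {M′} (suc f) (prime∤⇒coprime pr r∤M′))
      (order-^ N′ (subst (Order m x) (ℕ.*-comm (r ℕ.^ suc f) N′) ox)) (order-^ (r ℕ.^ f) og)

  record PrimitiveRoot (n : ℕ) (g : ℤ) (N : ℕ) : Set where
    field
      order     : Order (+ n) g N
      generates : ∀ {a} → Unit (+ n) a → ∃ λ k → a ≈ g ^ k [ + n ]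

  module _ {p} (pp : Prime p) where
    private instance
      p≢0 : NonZero p
      p≢0 = prime⇒nonZero pp

    Exponent : ℕ → Set
    Exponent N = ∀ {a} → Unit (+ p) a → a ^ N ≈ 1ℤ [ + p ]

    exponent? : ∀ N → Exponent N ⊎ (∃ λ a → Unit (+ p) a × ¬ a ^ N ≈ 1ℤ [ + p ])
    exponent? N = decide (ℕ.anyUpTo? (λ k → ¬? (+ k ≈? 0ℤ [ + p ]) ×-dec ¬? ((+ k) ^ N ≈? 1ℤ [ + p ])) p)
      where
      decide : Dec (∃ λ k → k ℕ.< p × ¬ + k ≈ 0ℤ [ + p ] × ¬ (+ k) ^ N ≈ 1ℤ [ + p ]) → _
      decide (yes (k , _ , k≉0 , k^N≉1)) = inj₂ (+ k , prime∧≉0⇒unit pp k≉0 , k^N≉1)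
      decide (no ¬∃) = inj₁ λ {a} ua → ≈-trans (^-cong N (%ℕ-≈ a p))
        (decidable-stable ((+ (a %ℕ p)) ^ N ≈? 1ℤ [ + p ]) λ a^N≉1 → ¬∃ (a %ℕ p , n%ℕd<d a p ,
          (λ a≈0 → unit⇒≉0 (prime⇒1< pp) ua (≈-trans (%ℕ-≈ a p) a≈0)) , a^N≉1))

    order-reaching-exponent : ∀ fuel {g N} → Order (+ p) g N → p ℕ.≤ N ℕ.+ fuel →
                              ∃ λ g → ∃ λ N → Order (+ p) g N × Exponent N
    order-reaching-exponent zero {N = N} og p≤N =
      contradiction (order-< (prime⇒1< pp) og) (ℕ.≤⇒≯ (subst (p ℕ.≤_) (ℕ.+-identityʳ N) p≤N))
    order-reaching-exponent (suc fuel) {g} {N} og p≤N+1+fuel = decide (exponent? N)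
      where
      continue : (∃ λ h → ∃ λ L → N ℕ.< L × Order (+ p) h L) → ∃ λ g → ∃ λ N → Order (+ p) g N × Exponent N
      continue (h , L , N<L , oh) = order-reaching-exponent fuel oh (ℕ.≤-trans p≤N+1+fuel
        (subst (ℕ._≤ L ℕ.+ fuel) (sym (ℕ.+-suc N fuel)) (ℕ.+-monoˡ-≤ fuel N<L)))
      decide : Exponent N ⊎ (∃ λ a → Unit (+ p) a × ¬ a ^ N ≈ 1ℤ [ + p ]) → ∃ λ g → ∃ λ N → Order (+ p) g N × Exponent N
      decide (inj₁ expN) = g , N , og , expN
      decide (inj₂ (a , ua , a^N≉1)) = continue (larger-order og (proj₂ (finite-order ua))
        λ K∣N → a^N≉1 (order∣⇒^≈1 (proj₂ (finite-order ua)) K∣N))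

    order-exponent⇒primitiveRoot : Order (+ p) g N → Exponent N → PrimitiveRoot p g N
    order-exponent⇒primitiveRoot {g} {N} og expN = record
      { order = og ; generates = λ {a} ua → decide ua (ℕ.anyUpTo? (λ k → a ≈? g ^ k [ + p ]) N) }
      where
      instance
        N≢0 : NonZero N
        N≢0 = Order.nonZero og
      distinct : ∀ {i j} → i ℕ.< j → j ℕ.< N → ¬ g ^ i ≈ g ^ j [ + p ]
      distinct {i} {j} i<j j<N g^i≈g^j = ℕ.<⇒≢ i<j
        (<∧≈⇒≡ (ℕ.<-trans i<j j<N) j<N (order⇒exponent-≈ og i j g^i≈g^j))
      decide : ∀ {a} → Unit (+ p) a → Dec (∃ λ k → k ℕ.< N × a ≈ g ^ k [ + p ]) → ∃ λ k → a ≈ g ^ k [ + p ]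
      decide _ (yes (k , _ , a≈g^k)) = k , a≈g^k
      decide {a} ua (no ¬∃) = contradiction
        (roots-of-unity≤ {k = N} pp (a ∷ applyUpTo (g ^_) N)
          (All.applyUpTo⁺₁ (g ^_) N (λ i<N a≈g^i → ¬∃ (_ , i<N , a≈g^i)) ∷ AllPairs.applyUpTo⁺₁ (g ^_) N distinct)
          (expN ua ∷ All.applyUpTo⁺₁ (g ^_) N (λ {i} _ → expN (unit-^ i (order⇒unit og)))))
        (ℕ.<⇒≱ (ℕ.s≤s (ℕ.≤-reflexive (sym (length-applyUpTo (g ^_) N)))))

    prime⇒primitiveRoot : ∃ λ g → ∃ λ N → PrimitiveRoot p g N
    prime⇒primitiveRoot = conclude (order-reaching-exponent p (proj₂ (finite-order {p} (unit-1 {+ p}))) (ℕ.m≤n+m p _))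
      where
      conclude : (∃ λ g → ∃ λ N → Order (+ p) g N × Exponent N) → _
      conclude (g , N , og , expN) = g , N , order-exponent⇒primitiveRoot og expN

module PrimePowerModulus where
  open import Data.Integer using (_*_; _^_)
  open Congruence
  open MultiplicativeOrder
  open PrimeDivisors
  open PrimeModulus

  private variable
    g : ℤ
    N : ℕ

  triangular : ℕ → ℤ
  triangular zero    = 0ℤ
  triangular (suc n) = triangular n + + n

  double-triangular : ∀ n → + 2 * triangular n ≡ (+ n - 1ℤ) * + n
  double-triangular zero    = refl
  double-triangular (suc n) =
    trans (lemma₁ (triangular n) (+ n)) (trans (cong (λ t → t + + 2 * + n) (double-triangular n)) (lemma₂ (+ n)))
    where
    lemma₁ : ∀ t n → + 2 * (t + n) ≡ + 2 * t + + 2 * n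
    lemma₁ = solve-∀
    lemma₂ : ∀ n → (n - 1ℤ) * n + + 2 * n ≡ (1ℤ + n - 1ℤ) * (1ℤ + n)
    lemma₂ = solve-∀

  binomial-expansion : ∀ x n → ∃ λ t → (1ℤ + x) ^ n ≡ 1ℤ + + n * x + triangular n * (x * x) + t * (x * x * x)
  binomial-expansion x zero = 0ℤ , lemma x
    where
    lemma : ∀ x → 1ℤ ≡ 1ℤ + 0ℤ * x + 0ℤ * (x * x) + 0ℤ * (x * x * x)
    lemma = solve-∀
  binomial-expansion x (suc n) = extend (binomial-expansion x n)
    where
    lemma : ∀ x n T t → (1ℤ + x) * (1ℤ + n * x + T * (x * x) + t * (x * x * x))
          ≡ 1ℤ + (1ℤ + n) * x + (T + n) * (x * x) + (t + T + t * x) * (x * x * x)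
    lemma = solve-∀
    extend : (∃ λ t → (1ℤ + x) ^ n ≡ 1ℤ + + n * x + triangular n * (x * x) + t * (x * x * x)) → _
    extend (t , eq) = t + triangular n + t * x ,
      trans (cong ((1ℤ + x) *_) eq) (lemma x (+ n) (triangular n) t)

  -- As p divides P, the terms of degree at least two vanish modulo p P.
  binomial-linear : ∀ p P′ u j → let P = p * P′ in
                    (1ℤ + P * u) ^ j ≈ 1ℤ + + j * u * P [ p * P ]
  binomial-linear p P′ u j = collect (binomial-expansion (p * P′ * u) j)
    where
    lemma : ∀ p P′ u j T t → let P = p * P′ ; x = P * u in
            1ℤ + j * x + T * (x * x) + t * (x * x * x) ≡ 1ℤ + j * u * P + (P′ * u * u * (T + t * x)) * (p * P)
    lemma = solve-∀
    x = p * P′ * u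
    collect : (∃ λ t → (1ℤ + x) ^ j ≡ 1ℤ + + j * x + triangular j * (x * x) + t * (x * x * x)) →
              (1ℤ + x) ^ j ≈ 1ℤ + + j * u * (p * P′) [ p * (p * P′) ]
    collect (t , eq) = congruent (P′ * u * u * (triangular j + t * x)) (trans eq (lemma p P′ u (+ j) (triangular j) t))

  binomial-twist : ∀ p g N s → g ^ N ≡ 1ℤ + s * p →
                   ∃ λ v → (g * (1ℤ + p)) ^ N ≡ 1ℤ + p * v × v ≈ s + + N [ p ]
  binomial-twist p g N s g^N≡ = collect (binomial-expansion p N)
    where
    lemma : ∀ s p N T t → let c = T + t * p in
      (1ℤ + s * p) * (1ℤ + N * p + T * (p * p) + t * (p * p * p)) ≡ 1ℤ + p * (s + N + (c + s * (N + c * p)) * p)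
    lemma = solve-∀
    collect : (∃ λ t → (1ℤ + p) ^ N ≡ 1ℤ + + N * p + triangular N * (p * p) + t * (p * p * p)) →
              ∃ λ v → (g * (1ℤ + p)) ^ N ≡ 1ℤ + p * v × v ≈ s + + N [ p ]
    collect (t , eq) = s + + N + w * p ,
      trans (^-distribʳ-* g (1ℤ + p) N) (trans (cong₂ _*_ g^N≡ eq) (lemma s p (+ N) (triangular N) t)) ,
      congruent w refl
      where
      c = triangular N + t * p
      w = c + s * (+ N + c * p)

  module _ {p} (pp : Prime p) (p-odd : ¬ 2 ℕ.∣ p) where
    private instance
      p≢0 : NonZero p
      p≢0 = prime⇒nonZero pp

    2≉0 : ¬ + 2 ≈ 0ℤ [ + p ]
    2≉0 2≈0 = p-odd (subst (2 ℕ.∣_)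
      (ℕ.≤-antisym (prime⇒1< pp) (ℕ.∣⇒≤ (≈0⇒∣ 2≈0))) ℕ.∣-refl)

    triangular≈0 : triangular p ≈ 0ℤ [ + p ]
    triangular≈0 = [ (λ 2≈0 → contradiction 2≈0 2≉0) , id ]′ (euclid-≈ {x = + 2} {y = triangular p} pp
      (congruent (+ p - 1ℤ) (trans (double-triangular p) (lemma ((+ p - 1ℤ) * + p)))))
      where
      lemma : ∀ x → x ≡ 0ℤ + x
      lemma = solve-∀

    -- Here p ≠ 2 matters: the quadratic term needs p ∣ p (p - 1) / 2.
    binomial-prime : ∀ P′ u → let P = + p * P′ in
                     ∃ λ v → (1ℤ + P * u) ^ p ≡ 1ℤ + + p * P * v × v ≈ u [ + p ]
    binomial-prime P′ u = collect (binomial-expansion (+ p * P′ * u) p) triangular≈0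
      where
      lemma : ∀ p P′ u T′ t → let P = p * P′ ; x = P * u in
              1ℤ + p * x + (0ℤ + T′ * p) * (x * x) + t * (x * x * x) ≡
              1ℤ + p * P * (u + (T′ * P′ * u * u + t * P′ * P′ * u * u * u) * p)
      lemma = solve-∀
      x = + p * P′ * u
      collect : (∃ λ t → (1ℤ + x) ^ p ≡ 1ℤ + + p * x + triangular p * (x * x) + t * (x * x * x)) →
                triangular p ≈ 0ℤ [ + p ] →
                ∃ λ v → (1ℤ + x) ^ p ≡ 1ℤ + + p * (+ p * P′) * v × v ≈ u [ + p ]
      collect (t , eq) (congruent T′ T≡) = u + c * + p ,
        trans eq (trans (cong (λ T → 1ℤ + + p * x + T * (x * x) + t * (x * x * x)) T≡) (lemma (+ p) P′ u T′ t)) ,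
        congruent c refl
        where c = T′ * P′ * u * u + t * P′ * P′ * u * u * u

    record LiftableRoot (α : ℕ) (g : ℤ) (N : ℕ) : Set where
      field
        primitiveRoot : PrimitiveRoot (p ℕ.^ suc α) g N
        u             : ℤ
        ^N≡           : g ^ N ≡ 1ℤ + + p * + (p ℕ.^ α) * u
        u≉0           : ¬ u ≈ 0ℤ [ + p ]

    module _ {α g N} (root : LiftableRoot α g N) where
      open LiftableRoot root
      open PrimitiveRoot primitiveRoot
      private
        P′ P : ℤ
        P′ = + (p ℕ.^ α)
        P = + p * P′

        P≡ : + (p ℕ.^ suc α) ≡ P
        P≡ = pos-* p (p ℕ.^ α)

        pP≡ : + (p ℕ.^ suc (suc α)) ≡ + p * P
        pP≡ = trans (pos-* p (p ℕ.^ suc α)) (cong (+ p *_) P≡)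

        instance
          P≢0 : NonZero ∣ P ∣
          P≢0 = subst (NonZero ∘ ∣_∣) P≡ (ℕ.m^n≢0 p (suc α))

        *P-cong : ∀ {x y} → x ≈ y [ + p ] → x * P ≈ y * P [ + p * P ]
        *P-cong {y = y} (congruent s refl) = congruent s (lemma y s (+ p) P)
          where
          lemma : ∀ y s p P → (y + s * p) * P ≡ y * P + s * (p * P)
          lemma = solve-∀

        *P-cancel : ∀ {x y} → x * P ≈ y * P [ + p * P ] → x ≈ y [ + p ]
        *P-cancel {x} {y} (congruent s eq) = congruent s (*-cancelʳ-≡ x (y + s * + p) P (trans eq (sym (lemma y s (+ p) P))))
          where
          lemma : ∀ y s p P → (y + s * p) * P ≡ y * P + s * (p * P)
          lemma = solve-∀

        g^N*j≈ : ∀ j → g ^ (N ℕ.* j) ≈ 1ℤ + + j * u * P [ + p * P ]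
        g^N*j≈ j = ≈-trans (≡⇒≈ (trans (sym (^-*-assoc g N j)) (cong (_^ j) ^N≡))) (binomial-linear (+ p) P′ u j)

        bp : ∃ λ v → (1ℤ + P * u) ^ p ≡ 1ℤ + + p * P * v × v ≈ u [ + p ]
        bp = binomial-prime P′ u

        g^Np≡ : g ^ (N ℕ.* p) ≡ 1ℤ + + p * P * proj₁ bp
        g^Np≡ = trans (sym (^-*-assoc g N p)) (trans (cong (_^ p) ^N≡) (proj₁ (proj₂ bp)))

        lifted-order : Order (+ (p ℕ.^ suc (suc α))) g (N ℕ.* p)
        lifted-order = record
          { nonZero = ℕ.m*n≢0 N p {{Order.nonZero order}}
          ; ^≈1 = subst (g ^ (N ℕ.* p) ≈ 1ℤ [_]) (sym pP≡)
                    (congruent (proj₁ bp) (trans g^Np≡ (cong (_+_ 1ℤ) (*-comm (+ p * P) (proj₁ bp)))))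
          ; ^≈1⇒∣ = λ k g^k≈1 → divides k (subst (g ^ k ≈ 1ℤ [_]) pP≡ g^k≈1)
          }
          where
          divides : ∀ k → g ^ k ≈ 1ℤ [ + p * P ] → N ℕ.* p ℕ.∣ k
          divides k g^k≈1 = factor (Order.^≈1⇒∣ order k (subst (g ^ k ≈ 1ℤ [_]) (sym P≡) (≈-*ʳ (+ p) g^k≈1)))
            where
            factor : N ℕ.∣ k → N ℕ.* p ℕ.∣ k
            factor (ℕ.divides j refl) = subst (N ℕ.* p ℕ.∣_) (ℕ.*-comm N j) (ℕ.*-monoʳ-∣ N (≈0⇒∣ {+ j} {+ p} j≈0))
              where
              ju≈0 : + j * u ≈ 0ℤ [ + p ]
              ju≈0 = *P-cancel (begin
                + j * u * P                        ≡⟨ lemma (+ j * u * P) ⟩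
                - 1ℤ + (1ℤ + + j * u * P)          ≈⟨ +-congˡ (- 1ℤ) (g^N*j≈ j) ⟨
                - 1ℤ + g ^ (N ℕ.* j)               ≡⟨ cong (λ e → - 1ℤ + g ^ e) (ℕ.*-comm N j) ⟩
                - 1ℤ + g ^ (j ℕ.* N)               ≈⟨ +-congˡ (- 1ℤ) g^k≈1 ⟩
                0ℤ                                 ∎)
                where
                open ≈-Reasoning (+ p * P)
                lemma : ∀ x → x ≡ - 1ℤ + (1ℤ + x)
                lemma = solve-∀
              j≈0 : + j ≈ 0ℤ [ + p ]
              j≈0 = [ id , (λ u≈0 → contradiction u≈0 u≉0) ]′ (euclid-≈ {x = + j} {y = u} pp ju≈0)

        lifted-generates : ∀ {a} → Unit (+ p * P) a → ∃ λ k → a ≈ g ^ k [ + p * P ]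
        lifted-generates {a} ua = adjust (generates (subst (λ m → Unit m a) (sym P≡) (unit-*ʳ (+ p) ua)))
          where
          adjust : (∃ λ k → a ≈ g ^ k [ + (p ℕ.^ suc α) ]) → ∃ λ k → a ≈ g ^ k [ + p * P ]
          adjust (k , congruent t a≡) = k ℕ.+ N ℕ.* j , (begin
            a                                      ≡⟨ trans a≡ (cong (λ m → g ^ k + t * m) P≡) ⟩
            g ^ k + t * P                          ≈⟨ +-congˡ (g ^ k) (*P-cong t≈) ⟩
            g ^ k + g ^ k * u * + j * P            ≡⟨ lemma (g ^ k) u (+ j) P ⟩
            g ^ k * (1ℤ + + j * u * P)             ≈⟨ *-congˡ (g ^ k) (g^N*j≈ j) ⟨
            g ^ k * g ^ (N ℕ.* j)                  ≡⟨ sym (^-distribˡ-+-* g k (N ℕ.* j)) ⟩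
            g ^ (k ℕ.+ N ℕ.* j)                    ∎)
            where
            open ≈-Reasoning (+ p * P)
            lemma : ∀ x u j P → x + x * u * j * P ≡ x * (1ℤ + j * u * P)
            lemma = solve-∀
            ug : Unit (+ p) g
            ug = unit-*ˡ P′ (subst (λ m → Unit m g) P≡ (order⇒unit order))
            ugu : Unit (+ p) (g ^ k * u)
            ugu = unit-* (unit-^ k ug) (prime∧≉0⇒unit pp u≉0)
            w : ℤ
            w = Unit.inverse ugu
            j : ℕ
            j = (w * t) %ℕ p
            t≈ : t ≈ g ^ k * u * + j [ + p ]
            t≈ = ≈-trans (≡⇒≈ (sym (*-identityˡ t))) (≈-trans (*-congʳ t (≈-sym (Unit.isInverse ugu)))
              (≈-trans (≡⇒≈ (*-assoc (g ^ k * u) w t)) (*-congˡ (g ^ k * u) (%ℕ-≈ (w * t) p))))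

      lift : LiftableRoot (suc α) g (N ℕ.* p)
      lift = record
        { primitiveRoot = record
            { order = lifted-order
            ; generates = λ {a} ua → subst (λ m → ∃ λ k → a ≈ g ^ k [ m ]) (sym pP≡)
                (lifted-generates (subst (λ m → Unit m a) pP≡ ua))
            }
        ; u   = proj₁ bp
        ; ^N≡ = trans g^Np≡ (cong (λ m → 1ℤ + + p * m * proj₁ bp) (sym P≡))
        ; u≉0 = λ v≈0 → u≉0 (≈-trans (≈-sym (proj₂ (proj₂ bp))) v≈0)
        }

    primitiveRoot-≈ : ∀ {g h n N} → g ≈ h [ + n ] → PrimitiveRoot n g N → PrimitiveRoot n h N
    primitiveRoot-≈ {g} {h} {n} {N} g≈h root = record
      { order = record
          { nonZero = Order.nonZero order
          ; ^≈1 = ≈-trans (^-cong N (≈-sym g≈h)) (Order.^≈1 order)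
          ; ^≈1⇒∣ = λ k h^k≈1 → Order.^≈1⇒∣ order k (≈-trans (^-cong k g≈h) h^k≈1)
          }
      ; generates = λ ua → let k , a≈g^k = generates ua in k , ≈-trans a≈g^k (^-cong k g≈h)
      }
      where open PrimitiveRoot root

    liftable : PrimitiveRoot p g N → ∀ s → g ^ N ≡ 1ℤ + + p * s → ¬ s ≈ 0ℤ [ + p ] → LiftableRoot 0 g N
    liftable {g} {N} root s g^N≡ s≉0 = record
      { primitiveRoot = subst (λ n → PrimitiveRoot n g N) (sym (ℕ.*-identityʳ p)) root
      ; u = s
      ; ^N≡ = trans g^N≡ (cong (λ m → 1ℤ + m * s) (sym (*-identityʳ (+ p))))
      ; u≉0 = s≉0
      }

    -- If g^N ≡ 1 modulo p², then g (1 + p) works instead of g, because p ∤ N.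
    exists-liftable : PrimitiveRoot p g N → ∃ λ h → LiftableRoot 0 h N
    exists-liftable {g} {N} root = quotient-case (Order.^≈1 order)
      where
      open PrimitiveRoot root
      instance
        N≢0 : NonZero N
        N≢0 = Order.nonZero order
      N≉0 : ¬ + N ≈ 0ℤ [ + p ]
      N≉0 N≈0 = ℕ.<⇒≱ (order-< (prime⇒1< pp) order) (ℕ.∣⇒≤ (≈0⇒∣ N≈0))
      g≈h : g ≈ g * (1ℤ + + p) [ + p ]
      g≈h = congruent (- g) (lemma g (+ p))
        where
        lemma : ∀ g p → g ≡ g * (1ℤ + p) + - g * p
        lemma = solve-∀
      twist : ∀ s → s ≈ 0ℤ [ + p ] → (∃ λ v → (g * (1ℤ + + p)) ^ N ≡ 1ℤ + + p * v × v ≈ s + + N [ + p ]) →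
              ∃ λ h → LiftableRoot 0 h N
      twist s s≈0 (v , h^N≡ , v≈s+N) = g * (1ℤ + + p) , liftable (primitiveRoot-≈ g≈h root) v h^N≡
        λ v≈0 → N≉0 (≈-trans (≈-sym (+-cong s≈0 (≈-refl {+ N}))) (≈-trans (≈-sym v≈s+N) v≈0))
      quotient-case : g ^ N ≈ 1ℤ [ + p ] → ∃ λ h → LiftableRoot 0 h N
      quotient-case (congruent s g^N≡) = decide (s ≈? 0ℤ [ + p ])
        where
        decide : Dec (s ≈ 0ℤ [ + p ]) → ∃ λ h → LiftableRoot 0 h N
        decide (yes s≈0) = twist s s≈0 (binomial-twist (+ p) g N s g^N≡)
        decide (no s≉0) = g , liftable root s (trans g^N≡ (cong (_+_ 1ℤ) (*-comm s (+ p)))) s≉0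

    exists-liftable-^ : ∀ α → ∃ λ g → ∃ λ N → LiftableRoot α g N
    exists-liftable-^ zero = base (prime⇒primitiveRoot pp)
      where
      base : (∃ λ g → ∃ λ N → PrimitiveRoot p g N) → ∃ λ g → ∃ λ N → LiftableRoot 0 g N
      base (g , N , root) = proj₁ (exists-liftable root) , N , proj₂ (exists-liftable root)
    exists-liftable-^ (suc α) = step (exists-liftable-^ α)
      where
      step : (∃ λ g → ∃ λ N → LiftableRoot α g N) → ∃ λ g → ∃ λ N → LiftableRoot (suc α) g N
      step (g , N , root) = g , N ℕ.* p , lift root

    prime-power⇒primitiveRoot : ∀ α → ∃ λ g → ∃ λ N → PrimitiveRoot (p ℕ.^ suc α) g N
    prime-power⇒primitiveRoot α = forget (exists-liftable-^ α)
      where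
      forget : (∃ λ g → ∃ λ N → LiftableRoot α g N) → ∃ λ g → ∃ λ N → PrimitiveRoot (p ℕ.^ suc α) g N
      forget (g , N , root) = g , N , LiftableRoot.primitiveRoot root

module Totient where
  open import Data.Integer using (_*_; _^_)
  open Congruence
  open MultiplicativeOrder
  open PrimeModulus

  private variable
    A : Set
    xs ys : List A
    g : ℤ
    n N : ℕ

  lookup-injective : Unique xs → ∀ i j → lookup xs i ≡ lookup xs j → i ≡ j
  lookup-injective (_    ∷ _)  Fin.zero    Fin.zero    _  = refl
  lookup-injective (x∉xs ∷ _)  Fin.zero    (Fin.suc j) eq = contradiction eq (All.lookup x∉xs (∈-lookup j))
  lookup-injective (x∉xs ∷ _)  (Fin.suc i) Fin.zero    eq = contradiction (sym eq) (All.lookup x∉xs (∈-lookup i))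
  lookup-injective (_    ∷ xs) (Fin.suc i) (Fin.suc j) eq = cong Fin.suc (lookup-injective xs i j eq)

  unique-⊆⇒length≤ : Unique xs → xs ⊆ ys → length xs ℕ.≤ length ys
  unique-⊆⇒length≤ {xs = xs} {ys} unique xs⊆ys = Fin.injective⇒≤ {f = position} λ {i} {j} eq →
    lookup-injective unique i j (trans (lookup-position i) (trans (cong (lookup ys) eq) (sym (lookup-position j))))
    where
    position : Fin (length xs) → Fin (length ys)
    position i = index (xs⊆ys (∈-lookup i))
    lookup-position : ∀ i → lookup xs i ≡ lookup ys (position i)
    lookup-position i = lookup-index (xs⊆ys (∈-lookup i))

  primitiveRoot⇒φ : 1 ℕ.< n → PrimitiveRoot n g N → φ n ≡ N
  primitiveRoot⇒φ {n} {g} {N} 1<n root = ℕ.≤-antisym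
    (subst (φ n ℕ.≤_) (length-applyUpTo power N) (unique-⊆⇒length≤ totatives-unique totatives⊆powers))
    (subst (ℕ._≤ φ n) (length-applyUpTo power N) (unique-⊆⇒length≤ powers-unique powers⊆totatives))
    where
    open PrimitiveRoot root
    instance
      n≢0 : NonZero n
      n≢0 = ℕ.>-nonZero (ℕ.<-trans (ℕ.s≤s ℕ.z≤n) 1<n)
      N≢0 : NonZero N
      N≢0 = Order.nonZero order
    power : ℕ → ℕ
    power k = (g ^ k) %ℕ n
    totatives powers : List ℕ
    totatives = filter (λ k → coprime? k n) (map suc (upTo n))
    powers = applyUpTo power N

    totatives-unique : Unique totatives
    totatives-unique = Unique.filter⁺ (λ k → coprime? k n) (Unique.map⁺ ℕ.suc-injective (Unique.upTo⁺ n))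

    powers-unique : Unique powers
    powers-unique = Unique.applyUpTo⁺₁ power N λ {i} {j} i<j j<N eq → ℕ.<⇒≢ i<j
      (<∧≈⇒≡ (ℕ.<-trans i<j j<N) j<N (order⇒exponent-≈ order i j
        (≈-trans (%ℕ-≈ (g ^ i) n) (≈-trans (≡⇒≈ (cong +_ eq)) (≈-sym (%ℕ-≈ (g ^ j) n))))))

    totatives⊆powers : totatives ⊆ powers
    totatives⊆powers {x} x∈ = reduce (∈-filter⁻ (λ k → coprime? k n) {xs = map suc (upTo n)} x∈)
      where
      reduce : x ∈ map suc (upTo n) × Coprime x n → x ∈ powers
      reduce (x∈range , x⊥n) = locate (generates (coprime⇒unit {+ x} {n} x⊥n)) (∈-map⁻ suc x∈range)
        where
        locate : (∃ λ k → + x ≈ g ^ k [ + n ]) → (∃ λ y → y ∈ upTo n × x ≡ suc y) → x ∈ powers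
        locate (k , x≈g^k) (y , y∈ , x≡1+y) = subst (_∈ powers) (sym x≡power) (∈-applyUpTo⁺ power (ℕ.m%n<n k N))
          where
          x≢n : x ≢ n
          x≢n refl = ℕ.<⇒≢ 1<n (sym (x⊥n (ℕ.∣-refl , ℕ.∣-refl)))
          x<n : x ℕ.< n
          x<n = ℕ.≤∧≢⇒< (subst (ℕ._≤ n) (sym x≡1+y) (∈-upTo⁻ y∈)) x≢n
          k≈k%N : + k ≈ + (k ℕ.% N) [ + N ]
          k≈k%N = ≡+*⇒≈ (k ℕ./ N) (ℕ.m≡m%n+[m/n]*n k N)
          x≡power : x ≡ power (k ℕ.% N)
          x≡power = <∧≈⇒≡ x<n (n%ℕd<d (g ^ (k ℕ.% N)) n)
            (≈-trans x≈g^k (≈-trans (order⇒exponent-cong order k≈k%N) (%ℕ-≈ (g ^ (k ℕ.% N)) n)))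

    powers⊆totatives : powers ⊆ totatives
    powers⊆totatives {x} x∈ = locate (∈-applyUpTo⁻ power x∈)
      where
      locate : (∃ λ k → k ℕ.< N × x ≡ power k) → x ∈ totatives
      locate (k , _ , x≡) = ∈-filter⁺ (λ k → coprime? k n) (in-range x unit-x x<n) (unit⇒coprime unit-x)
        where
        unit-x : Unit (+ n) (+ x)
        unit-x = subst (Unit (+ n) ∘ +_) (sym x≡) (unit-≈ (%ℕ-≈ (g ^ k) n) (unit-^ k (order⇒unit order)))
        x<n : x ℕ.< n
        x<n = subst (ℕ._< n) (sym x≡) (n%ℕd<d (g ^ k) n)
        in-range : ∀ x → Unit (+ n) (+ x) → x ℕ.< n → x ∈ map suc (upTo n)
        in-range zero    u₀ _   = contradiction (≈-refl {0ℤ}) (unit⇒≉0 1<n u₀)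
        in-range (suc y) _  y<n = ∈-map⁺ suc (∈-upTo⁺ (ℕ.<-trans (ℕ.n<1+n y) y<n))

module CyclicQuotient where
  open import Data.Integer using (_*_; _^_)
  open Congruence
  open MultiplicativeOrder
  open PrimeDivisors
  open PrimeModulus

  private variable
    g h : ℤ
    a b n N P Q : ℕ

  -1≉1 : 1 ℕ.< n → ¬ 2 ℕ.∣ n → ¬ - 1ℤ ≈ 1ℤ [ + n ]
  -1≉1 {n} 1<n 2∤n -1≈1 = 2∤n (subst (2 ℕ.∣_) (ℕ.≤-antisym 1<n (ℕ.∣⇒≤ (≈⇒∣ -1≈1))) ℕ.∣-refl)

  module _ (1<n : 1 ℕ.< n) (2∤n : ¬ 2 ℕ.∣ n) (root : PrimitiveRoot n g N) where
    open PrimitiveRoot root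

    log[-1] : ∃ λ l → - 1ℤ ≈ g ^ l [ + n ]
    log[-1] = generates (unit-neg unit-1)

    private
      l : ℕ
      l = proj₁ log[-1]

    N∤l : ¬ N ℕ.∣ l
    N∤l N∣l = -1≉1 1<n 2∤n (≈-trans (proj₂ log[-1]) (order∣⇒^≈1 order N∣l))

    N∣2l : N ℕ.∣ 2 ℕ.* l
    N∣2l = subst (N ℕ.∣_) (cong (l ℕ.+_) (sym (ℕ.+-identityʳ l))) (Order.^≈1⇒∣ order (l ℕ.+ l)
      (≈-trans (≡⇒≈ (^-distribˡ-+-* g l l)) (≈-sym (*-cong (proj₂ log[-1]) (proj₂ log[-1])))))

    even-order : 2 ℕ.∣ N
    even-order = decide (2 ℕ.∣? N)
      where
      decide : Dec (2 ℕ.∣ N) → 2 ℕ.∣ N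
      decide (yes 2∣N) = 2∣N
      decide (no 2∤N) = contradiction
        (coprime-divisor (Coprimality.sym (prime∤⇒coprime prime[2] 2∤N)) N∣2l) N∤l

  -- If the logarithm l of -1 were even, g^l ≡ -1 would force the order 2N to divide 2l with N odd, hence to divide l.
  odd-log[-1] : (1<n : 1 ℕ.< n) (2∤n : ¬ 2 ℕ.∣ n) (root : PrimitiveRoot n g (2 ℕ.* N)) → ¬ 2 ℕ.∣ N →
                ¬ 2 ℕ.∣ proj₁ (log[-1] 1<n 2∤n root)
  odd-log[-1] {N = N} 1<n 2∤n root 2∤N (ℕ.divides i l≡i2) = N∤l 1<n 2∤n root
    (subst (2 ℕ.* N ℕ.∣_) (sym l≡2i) (ℕ.*-monoʳ-∣ 2 (coprime-divisor {o = i}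
      (Coprimality.sym (prime∤⇒coprime prime[2] 2∤N))
      (subst (N ℕ.∣_) l≡2i (ℕ.*-cancelˡ-∣ 2 (N∣2l 1<n 2∤n root))))))
    where l≡2i = trans l≡i2 (ℕ.*-comm i 2)

  primitiveRoot⇒cyclic : PrimitiveRoot n g N → G⋆-cyclic n
  primitiveRoot⇒cyclic {n} {g} root = g , unit⇒coprime (order⇒unit order) , λ a a⊥n →
    let k , a≈g^k = generates (coprime⇒unit {a} {n} a⊥n) in k , inj₁ (≈⇒∣ a≈g^k)
    where open PrimitiveRoot root

  simultaneous-exponent : .{{_ : NonZero a}} → .{{_ : NonZero b}} → Coprime a b → ∀ i j →
                          ∃ λ k → + k ≈ + i [ + a ] × + k ≈ + j [ + b ]
  simultaneous-exponent {a} {b} a⊥b i j = reduce (chinese-remainder (unit-sym (coprime⇒unit {+ a} {b} a⊥b)) (+ i) (+ j))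
    where
    instance
      ab≢0 : NonZero (a ℕ.* b)
      ab≢0 = ℕ.m*n≢0 a b
    reduce : (∃ λ z → z ≈ + i [ + a ] × z ≈ + j [ + b ]) → _
    reduce (z , z≈i , z≈j) = z %ℕ (a ℕ.* b) ,
      ≈-trans (≈-sym (≈-*ˡ (+ b) z≈k)) z≈i , ≈-trans (≈-sym (≈-*ʳ (+ a) z≈k)) z≈j
      where
      z≈k : z ≈ + (z %ℕ (a ℕ.* b)) [ + a * + b ]
      z≈k = ≈-pos-*⁻ a b (%ℕ-≈ z (a ℕ.* b))

  -- h² generates the squares modulo Q, and exactly one of x, -x is a square modulo Q
  -- because -1 is an odd power of h.
  primitiveRoots⇒cyclic : 1 ℕ.< Q → ¬ 2 ℕ.∣ Q → Unit (+ P) (+ Q) →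
    PrimitiveRoot P g a → PrimitiveRoot Q h (2 ℕ.* b) → ¬ 2 ℕ.∣ b → Coprime a b → G⋆-cyclic (P ℕ.* Q)
  primitiveRoots⇒cyclic {Q} {P} {g} {a} {h} {b} 1<Q 2∤Q P⊥Q rootP rootQ 2∤b a⊥b =
    generator (chinese-remainder P⊥Q g (h ^ 2))
    where
    module rootP = PrimitiveRoot rootP
    module rootQ = PrimitiveRoot rootQ
    order-h² : Order (+ Q) (h ^ 2) b
    order-h² = order-^ 2 rootQ.order
    instance
      a≢0 : NonZero a
      a≢0 = Order.nonZero rootP.order
      b≢0 : NonZero b
      b≢0 = Order.nonZero order-h²
    generator : (∃ λ w → w ≈ g [ + P ] × w ≈ h ^ 2 [ + Q ]) → G⋆-cyclic (P ℕ.* Q)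
    generator (w , w≈g , w≈h²) = w , unit⇒coprime unit-w , λ x x⊥n → generates x (unit-pos x x⊥n)
      where
      unit-w : Unit (+ (P ℕ.* Q)) w
      unit-w = subst (λ m → Unit m w) (sym (pos-* P Q)) (unit-modulus-*
        (unit-≈ (≈-sym w≈g) (order⇒unit rootP.order)) (unit-≈ (≈-sym w≈h²) (order⇒unit order-h²)))
      unit-pos : ∀ x → Coprime ∣ x ∣ (P ℕ.* Q) → Unit (+ P * + Q) x
      unit-pos x x⊥n = subst (λ m → Unit m x) (pos-* P Q) (coprime⇒unit {x} {P ℕ.* Q} x⊥n)

      square : ∀ {x} → Unit (+ P * + Q) x → ∀ j → 2 ℕ.∣ j → x ≈ h ^ j [ + Q ] →
               ∃ λ k → x ≈ w ^ k [ + (P ℕ.* Q) ]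
      square {x} ux j (ℕ.divides j′ j≡j′2) x≈h^j = solve (rootP.generates (unit-*ˡ (+ Q) ux))
        where
        x≈h²^j′ : x ≈ (h ^ 2) ^ j′ [ + Q ]
        x≈h²^j′ = ≈-trans x≈h^j (≡⇒≈ (trans (cong (h ^_) (trans j≡j′2 (ℕ.*-comm j′ 2))) (sym (^-*-assoc h 2 j′))))
        solve : (∃ λ i → x ≈ g ^ i [ + P ]) → ∃ λ k → x ≈ w ^ k [ + (P ℕ.* Q) ]
        solve (i , x≈g^i) = join (simultaneous-exponent {a} {b} a⊥b i j′)
          where
          join : (∃ λ k → + k ≈ + i [ + a ] × + k ≈ + j′ [ + b ]) → ∃ λ k → x ≈ w ^ k [ + (P ℕ.* Q) ]
          join (k , k≈i , k≈j′) = k , ≈-pos-*⁺ P Q (≈-modulus-* P⊥Q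
            (≈-trans x≈g^i (≈-sym (≈-trans (^-cong k w≈g) (order⇒exponent-cong rootP.order k≈i))))
            (≈-trans x≈h²^j′ (≈-sym (≈-trans (^-cong k w≈h²) (order⇒exponent-cong order-h² k≈j′)))))

      generates : ∀ x → Unit (+ P * + Q) x → ∃ λ k → x ≡⋆ w ^ k [mod P ℕ.* Q ]
      generates x ux = logarithm (rootQ.generates (unit-*ʳ (+ P) ux))
        where
        positive : (∃ λ k → x ≈ w ^ k [ + (P ℕ.* Q) ]) → ∃ λ k → x ≡⋆ w ^ k [mod P ℕ.* Q ]
        positive (k , x≈w^k) = k , inj₁ (≈⇒∣ x≈w^k)
        negative : (∃ λ k → - x ≈ w ^ k [ + (P ℕ.* Q) ]) → ∃ λ k → x ≡⋆ w ^ k [mod P ℕ.* Q ]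
        negative (k , -x≈w^k) = k , inj₂ (≈0⇒∣ (≈-trans (+-congˡ x (≈-sym -x≈w^k)) (≡⇒≈ (lemma x))))
          where
          lemma : ∀ x → x + - x ≡ 0ℤ
          lemma = solve-∀
        logarithm : (∃ λ j → x ≈ h ^ j [ + Q ]) → ∃ λ k → x ≡⋆ w ^ k [mod P ℕ.* Q ]
        logarithm (j , x≈h^j) = decide (2 ℕ.∣? j)
          where
          l = proj₁ (log[-1] 1<Q 2∤Q rootQ)
          -x≈ : - x ≈ h ^ (l ℕ.+ j) [ + Q ]
          -x≈ = ≈-trans (≡⇒≈ (lemma x)) (≈-trans (*-cong (proj₂ (log[-1] 1<Q 2∤Q rootQ)) x≈h^j)
            (≡⇒≈ (sym (^-distribˡ-+-* h l j))))
            where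
            lemma : ∀ x → - x ≡ - 1ℤ * x
            lemma = solve-∀
          decide : Dec (2 ℕ.∣ j) → ∃ λ k → x ≡⋆ w ^ k [mod P ℕ.* Q ]
          decide (yes 2∣j) = positive (square ux j 2∣j x≈h^j)
          decide (no 2∤j) = negative (square (unit-neg ux) (l ℕ.+ j)
            (odd+odd (odd-log[-1] 1<Q 2∤Q rootQ 2∤b) 2∤j) -x≈)

module Classification where
  open import Data.Integer using (_*_; _^_)
  open Congruence
  open MultiplicativeOrder
  open PrimeDivisors
  open PrimeModulus
  open PrimePowerModulus
  open Totient
  open CyclicQuotient

  private variable
    g : ℤ
    c d n p q N : ℕ

  -- A witness that the d-th powers have index at least c in the group of units modulo n.
  record Independent (n d c : ℕ) : Set where
    field
      element   : Fin c → ℤ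
      isUnit    : ∀ i → Unit (+ n) (element i)
      separated : ∀ i j {y} → Unit (+ n) y → element i ≈ element j * y ^ d [ + n ] → i ≡ j

  independent-1 : Independent n d 1
  independent-1 = record
    { element = λ _ → 1ℤ ; isUnit = λ _ → unit-1 ; separated = λ { Fin.zero Fin.zero _ _ → refl } }

  primitiveRoot⇒independent : .{{_ : NonZero d}} → d ℕ.∣ N → PrimitiveRoot n g N → Independent n d d
  primitiveRoot⇒independent {d} {N} {n} {g} (ℕ.divides q refl) root = record
    { element   = λ i → g ^ toℕ i
    ; isUnit    = λ i → unit-^ (toℕ i) (order⇒unit order)
    ; separated = λ i j uy g^i≈ → Fin.toℕ-injective (<∧≈⇒≡ (Fin.toℕ<n i) (Fin.toℕ<n j)
        (logarithm (toℕ i) (toℕ j) g^i≈ (generates uy)))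
    }
    where
    open PrimitiveRoot root
    logarithm : ∀ i j {y} → g ^ i ≈ g ^ j * y ^ d [ + n ] → (∃ λ s → y ≈ g ^ s [ + n ]) → + i ≈ + j [ + d ]
    logarithm i j {y} g^i≈ (s , y≈g^s) = ≈-trans
      (≈-*ʳ (+ q) (≈-pos-*⁻ q d (order⇒exponent-≈ order i (j ℕ.+ s ℕ.* d) (begin
        g ^ i                     ≈⟨ g^i≈ ⟩
        g ^ j * y ^ d             ≈⟨ *-congˡ (g ^ j) (^-cong d y≈g^s) ⟩
        g ^ j * (g ^ s) ^ d       ≡⟨ cong (g ^ j *_) (^-*-assoc g s d) ⟩
        g ^ j * g ^ (s ℕ.* d)     ≡⟨ sym (^-distribˡ-+-* g j (s ℕ.* d)) ⟩
        g ^ (j ℕ.+ s ℕ.* d)       ∎))))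
      (≡+*⇒≈ s refl)
      where open ≈-Reasoning (+ n)

  independent-* : ∀ {P Q d c c′} → Unit (+ P) (+ Q) → Independent P d c → Independent Q d c′ → Independent (P ℕ.* Q) d (c ℕ.* c′)
  independent-* {P} {Q} {d} {c} {c′} P⊥Q indP indQ = record
    { element   = λ i → proj₁ (glue i)
    ; isUnit    = λ i → subst (λ m → Unit m (proj₁ (glue i))) (sym (pos-* P Q)) (unit-modulus-*
        (unit-≈ (≈-sym (glueP i)) (indP.isUnit (left i))) (unit-≈ (≈-sym (glueQ i)) (indQ.isUnit (right i))))
    ; separated = λ i j uy eq → coordinates i j
        (indP.separated (left i) (left j) (unit-*ˡ (+ Q) (unit⁻ uy))
          (≈-trans (≈-sym (glueP i)) (≈-trans (≈-*ˡ (+ Q) (≈-pos-*⁻ P Q eq)) (*-congʳ _ (glueP j)))))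
        (indQ.separated (right i) (right j) (unit-*ʳ (+ P) (unit⁻ uy))
          (≈-trans (≈-sym (glueQ i)) (≈-trans (≈-*ʳ (+ P) (≈-pos-*⁻ P Q eq)) (*-congʳ _ (glueQ j)))))
    }
    where
    module indP = Independent indP
    module indQ = Independent indQ
    left : Fin (c ℕ.* c′) → Fin c
    left i = proj₁ (remQuot c′ i)
    right : Fin (c ℕ.* c′) → Fin c′
    right i = proj₂ (remQuot {c} c′ i)
    glue : ∀ i → ∃ λ x → x ≈ indP.element (left i) [ + P ] × x ≈ indQ.element (right i) [ + Q ]
    glue i = chinese-remainder P⊥Q (indP.element (left i)) (indQ.element (right i))
    glueP : ∀ i → proj₁ (glue i) ≈ indP.element (left i) [ + P ]
    glueP i = proj₁ (proj₂ (glue i))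
    glueQ : ∀ i → proj₁ (glue i) ≈ indQ.element (right i) [ + Q ]
    glueQ i = proj₂ (proj₂ (glue i))
    unit⁻ : ∀ {y} → Unit (+ (P ℕ.* Q)) y → Unit (+ P * + Q) y
    unit⁻ {y} = subst (λ m → Unit m y) (pos-* P Q)
    coordinates : ∀ i j → left i ≡ left j → right i ≡ right j → i ≡ j
    coordinates i j l≡ r≡ = trans (sym (Fin.combine-remQuot {c} c′ i))
      (trans (cong₂ combine l≡ r≡) (Fin.combine-remQuot {c} c′ j))

  sign : Fin 2 → ℤ
  sign Fin.zero    = 1ℤ
  sign (Fin.suc _) = - 1ℤ

  -- Every unit is ± a power of the generator, so units modulo d-th powers have at most 2 d classes.
  cyclic⇒independent≤ : .{{_ : NonZero d}} → G⋆-cyclic n → Independent n d c → c ℕ.≤ 2 ℕ.* d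
  cyclic⇒independent≤ {d} {n} {c} (g , g⊥n , generates) ind = Fin.injective⇒≤ {f = class} λ {i} {j} → class-injective i j
    where
    open Independent ind
    ug : Unit (+ n) g
    ug = coprime⇒unit {g} {n} g⊥n
    signed-power : ∀ x → Unit (+ n) x → ∃ λ ε → ∃ λ k → x ≈ sign ε * g ^ k [ + n ]
    signed-power x ux = convert (generates x (unit⇒coprime ux))
      where
      convert : (∃ λ k → x ≡⋆ g ^ k [mod n ]) → ∃ λ ε → ∃ λ k → x ≈ sign ε * g ^ k [ + n ]
      convert (k , inj₁ n∣x-g^k) = Fin.zero , k ,
        ≈-trans (∣⇒≈ {+ n} {x} {g ^ k} n∣x-g^k) (≡⇒≈ (sym (*-identityˡ (g ^ k))))
      convert (k , inj₂ n∣x+g^k) = Fin.suc Fin.zero , k ,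
        ≈-trans (≡⇒≈ (lemma₁ x (g ^ k))) (≈-trans (+-cong (∣⇒≈0 {+ n} {x + g ^ k} n∣x+g^k) (≈-refl { - g ^ k})) (≡⇒≈ (lemma₂ (g ^ k))))
        where
        lemma₁ : ∀ x y → x ≡ x + y + - y
        lemma₁ = solve-∀
        lemma₂ : ∀ y → 0ℤ + - y ≡ - 1ℤ * y
        lemma₂ = solve-∀
    ε : Fin c → Fin 2
    ε i = proj₁ (signed-power (element i) (isUnit i))
    k : Fin c → ℕ
    k i = proj₁ (proj₂ (signed-power (element i) (isUnit i)))
    element≈ : ∀ i → element i ≈ sign (ε i) * g ^ k i [ + n ]
    element≈ i = proj₂ (proj₂ (signed-power (element i) (isUnit i)))
    class : Fin c → Fin (2 ℕ.* d)
    class i = combine (ε i) (residue d (+ k i))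
    shift : ∀ i j → ε i ≡ ε j → ∀ q → k i ≡ k j ℕ.+ q ℕ.* d → i ≡ j
    shift i j ε≡ q k≡ = separated i j (unit-^ q ug) (begin
      element i                              ≈⟨ element≈ i ⟩
      sign (ε i) * g ^ k i                   ≡⟨ cong₂ (λ e l → sign e * g ^ l) ε≡ k≡ ⟩
      sign (ε j) * g ^ (k j ℕ.+ q ℕ.* d)     ≡⟨ cong (sign (ε j) *_) (^-distribˡ-+-* g (k j) (q ℕ.* d)) ⟩
      sign (ε j) * (g ^ k j * g ^ (q ℕ.* d)) ≡⟨ sym (*-assoc (sign (ε j)) (g ^ k j) (g ^ (q ℕ.* d))) ⟩
      sign (ε j) * g ^ k j * g ^ (q ℕ.* d)   ≡⟨ cong (sign (ε j) * g ^ k j *_) (sym (^-*-assoc g q d)) ⟩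
      sign (ε j) * g ^ k j * (g ^ q) ^ d     ≈⟨ *-congʳ ((g ^ q) ^ d) (element≈ j) ⟨
      element j * (g ^ q) ^ d                ∎)
      where open ≈-Reasoning (+ n)
    class-injective : ∀ i j → class i ≡ class j → i ≡ j
    class-injective i j eq = compare (Fin.combine-injective (ε i) (residue d (+ k i)) (ε j) (residue d (+ k j)) eq)
      where
      compare : ε i ≡ ε j × residue d (+ k i) ≡ residue d (+ k j) → i ≡ j
      compare (ε≡ , k≡) = [ (λ { (q , eq) → shift i j ε≡ q eq }) , (λ { (q , eq) → sym (shift j i (sym ε≡) q eq) }) ]′
        (≈⇒≡+* (residue-injective k≡))

  odd-prime-power-independent : Prime p → ¬ 2 ℕ.∣ p → ∀ α → Independent (p ℕ.^ suc α) 2 2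
  odd-prime-power-independent pp 2∤p α =
    let g , N , root = prime-power⇒primitiveRoot pp 2∤p α in
    primitiveRoot⇒independent (even-order (1<p^ pp α) (2∤⇒2∤^ (suc α) 2∤p) root) root

  gcd-φ≡2 : ∀ α β → Prime p → Prime q → ¬ 2 ℕ.∣ p → ¬ 2 ℕ.∣ q → Unit (+ (p ℕ.^ suc α)) (+ (q ℕ.^ suc β)) →
            G⋆-cyclic (p ℕ.^ suc α ℕ.* q ℕ.^ suc β) → gcd (φ (p ℕ.^ suc α)) (φ (q ℕ.^ suc β)) ≡ 2
  gcd-φ≡2 {p} {q} α β pp pq 2∤p 2∤q P⊥Q cyclic =
    compute (prime-power⇒primitiveRoot pp 2∤p α) (prime-power⇒primitiveRoot pq 2∤q β)
    where
    P = p ℕ.^ suc α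
    Q = q ℕ.^ suc β
    compute : (∃ λ g → ∃ λ a → PrimitiveRoot P g a) → (∃ λ h → ∃ λ b → PrimitiveRoot Q h b) → gcd (φ P) (φ Q) ≡ 2
    compute (g , a , rootP) (h , b , rootQ) =
      trans (cong₂ gcd (primitiveRoot⇒φ (1<p^ pp α) rootP) (primitiveRoot⇒φ (1<p^ pq β) rootQ)) (ℕ.≤-antisym
        (ℕ.*-cancelʳ-≤ (gcd a b) 2 (gcd a b) (cyclic⇒independent≤ cyclic (independent-* P⊥Q
          (primitiveRoot⇒independent (gcd[m,n]∣m a b) rootP) (primitiveRoot⇒independent (gcd[m,n]∣n a b) rootQ))))
        (ℕ.∣⇒≤ (gcd-greatest (even-order (1<p^ pp α) (2∤⇒2∤^ (suc α) 2∤p) rootP)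
                              (even-order (1<p^ pq β) (2∤⇒2∤^ (suc β) 2∤q) rootQ))))
      where
      instance
        d≢0 : NonZero (gcd a b)
        d≢0 = ℕ.≢-nonZero (gcd[m,n]≢0 a b (inj₁ (ℕ.≢-nonZero⁻¹ a {{Order.nonZero (PrimitiveRoot.order rootP)}})))

  three-primes⇒¬cyclic : ∀ {p q r m} α β γ → Prime p → Prime q → Prime r → ¬ 2 ℕ.∣ p → ¬ 2 ℕ.∣ q → ¬ 2 ℕ.∣ r →
    ¬ p ℕ.∣ q ℕ.^ suc β ℕ.* (r ℕ.^ suc γ ℕ.* m) → ¬ q ℕ.∣ r ℕ.^ suc γ ℕ.* m → ¬ r ℕ.∣ m →
    ¬ G⋆-cyclic (p ℕ.^ suc α ℕ.* (q ℕ.^ suc β ℕ.* (r ℕ.^ suc γ ℕ.* m)))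
  three-primes⇒¬cyclic α β γ pp pq pr 2∤p 2∤q 2∤r p∤ q∤ r∤ cyclic = ℕ.<⇒≱ (ℕ.m≤m+n 5 3) (cyclic⇒independent≤ cyclic
    (independent-* (prime-power-unit (suc α) pp p∤) (odd-prime-power-independent pp 2∤p α)
      (independent-* (prime-power-unit (suc β) pq q∤) (odd-prime-power-independent pq 2∤q β)
        (independent-* (prime-power-unit (suc γ) pr r∤) (odd-prime-power-independent pr 2∤r γ) independent-1))))

  PrimePower TwoPrimePowers : ℕ → Set
  PrimePower n = Σ ℕ λ p → Σ ℕ λ α → Prime p × ¬ 2 ℕ.∣ p × α ℕ.≥ 1 × n ≡ p ℕ.^ α
  TwoPrimePowers n = Σ ℕ λ p → Σ ℕ λ q → Σ ℕ λ α → Σ ℕ λ β →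
    Prime p × Prime q × ¬ 2 ℕ.∣ p × ¬ 2 ℕ.∣ q × p ≢ q × α ℕ.≥ 1 × β ℕ.≥ 1 ×
    n ≡ p ℕ.^ α ℕ.* q ℕ.^ β × gcd (φ (p ℕ.^ α)) (φ (q ℕ.^ β)) ≡ 2

  cyclic⇒form : 1 ℕ.< n → ¬ 2 ℕ.∣ n → G⋆-cyclic n → PrimePower n ⊎ TwoPrimePowers n
  cyclic⇒form {n} 1<n 2∤n cyclic = first (prime-power-factor 1<n)
    where
    first : PrimePowerFactor n → PrimePower n ⊎ TwoPrimePowers n
    first (p , α , m , pp , refl , p∤m) = decide (m ℕ.≟ 1)
      where
      P = p ℕ.^ suc α
      2∤p : ¬ 2 ℕ.∣ p
      2∤p = 2∤*⇒2∤ˡ (p ℕ.^ α) (2∤*⇒2∤ˡ m 2∤n)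
      2∤m : ¬ 2 ℕ.∣ m
      2∤m = 2∤*⇒2∤ʳ P 2∤n
      second : ∀ {m} → ¬ 2 ℕ.∣ m → ¬ p ℕ.∣ m → G⋆-cyclic (P ℕ.* m) → PrimePowerFactor m → TwoPrimePowers (P ℕ.* m)
      second 2∤m p∤m cyclic (q , β , m′ , pq , refl , q∤m′) = decide′ (m′ ℕ.≟ 1)
        where
        Q = q ℕ.^ suc β
        2∤q : ¬ 2 ℕ.∣ q
        2∤q = 2∤*⇒2∤ˡ (q ℕ.^ β) (2∤*⇒2∤ˡ m′ 2∤m)
        p∤Q : ¬ p ℕ.∣ Q
        p∤Q p∣Q = p∤m (ℕ.∣m⇒∣m*n m′ p∣Q)
        p≢q : p ≢ q
        p≢q refl = p∤Q (ℕ.m∣m*n (q ℕ.^ β))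
        third : ∀ {m} → ¬ p ℕ.∣ Q ℕ.* m → ¬ q ℕ.∣ m → ¬ 2 ℕ.∣ m → G⋆-cyclic (P ℕ.* (Q ℕ.* m)) → ¬ PrimePowerFactor m
        third p∤ q∤ 2∤m cyclic (r , γ , m″ , pr , refl , r∤m″) = three-primes⇒¬cyclic α β γ pp pq pr 2∤p 2∤q
          (2∤*⇒2∤ˡ (r ℕ.^ γ) (2∤*⇒2∤ˡ m″ 2∤m)) p∤ q∤ r∤m″ cyclic
        decide′ : Dec (m′ ≡ 1) → TwoPrimePowers (P ℕ.* (Q ℕ.* m′))
        decide′ (yes m′≡1) = p , q , suc α , suc β , pp , pq , 2∤p , 2∤q , p≢q , ℕ.s≤s ℕ.z≤n , ℕ.s≤s ℕ.z≤n , n≡ ,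
          gcd-φ≡2 α β pp pq 2∤p 2∤q (prime-power-unit (suc α) pp p∤Q) (subst G⋆-cyclic n≡ cyclic)
          where
          n≡ : P ℕ.* (Q ℕ.* m′) ≡ P ℕ.* Q
          n≡ = cong (P ℕ.*_) (trans (cong (Q ℕ.*_) m′≡1) (ℕ.*-identityʳ Q))
        decide′ (no m′≢1) = contradiction (prime-power-factor (odd>1 2∤m′ m′≢1)) (third p∤m q∤m′ 2∤m′ cyclic)
          where
          2∤m′ : ¬ 2 ℕ.∣ m′
          2∤m′ = 2∤*⇒2∤ʳ Q 2∤m
      decide : Dec (m ≡ 1) → PrimePower (P ℕ.* m) ⊎ TwoPrimePowers (P ℕ.* m)
      decide (yes m≡1) = inj₁ (p , suc α , pp , 2∤p , ℕ.s≤s ℕ.z≤n , trans (cong (P ℕ.*_) m≡1) (ℕ.*-identityʳ P))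
      decide (no m≢1) = inj₂ (second 2∤m p∤m cyclic (prime-power-factor (odd>1 2∤m m≢1)))

  primePower⇒cyclic : PrimePower n → G⋆-cyclic n
  primePower⇒cyclic (p , suc α , pp , 2∤p , _ , refl) = conclude (prime-power⇒primitiveRoot pp 2∤p α)
    where
    conclude : (∃ λ g → ∃ λ N → PrimitiveRoot (p ℕ.^ suc α) g N) → G⋆-cyclic (p ℕ.^ suc α)
    conclude (_ , _ , root) = primitiveRoot⇒cyclic root

  primitiveRoots-gcd≡2⇒cyclic : ∀ {P Q g a h b} → 1 ℕ.< P → 1 ℕ.< Q → ¬ 2 ℕ.∣ P → ¬ 2 ℕ.∣ Q → Unit (+ P) (+ Q) →
    PrimitiveRoot P g a → PrimitiveRoot Q h b → gcd a b ≡ 2 → G⋆-cyclic (P ℕ.* Q)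
  primitiveRoots-gcd≡2⇒cyclic {P} {Q} {g} {a} {h} {b} 1<P 1<Q 2∤P 2∤Q P⊥Q rootP rootQ gcd≡2 =
    halve (subst (ℕ._∣ a) gcd≡2 (gcd[m,n]∣m a b)) (subst (ℕ._∣ b) gcd≡2 (gcd[m,n]∣n a b))
    where
    common∣2 : ∀ {e} → e ℕ.∣ a → e ℕ.∣ b → e ℕ.∣ 2
    common∣2 e∣a e∣b = subst (_ ℕ.∣_) gcd≡2 (gcd-greatest e∣a e∣b)
    odd∣2⇒≡1 : ∀ {e c} → ¬ 2 ℕ.∣ c → e ℕ.∣ c → e ℕ.∣ 2 → e ≡ 1
    odd∣2⇒≡1 2∤c e∣c e∣2 = [ id , (λ { refl → contradiction e∣c 2∤c }) ]′ (prime⇒irreducible prime[2] e∣2)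
    halve : 2 ℕ.∣ a → 2 ℕ.∣ b → G⋆-cyclic (P ℕ.* Q)
    halve (ℕ.divides a′ a≡a′2) (ℕ.divides b′ b≡b′2) = decide (2 ℕ.∣? b′)
      where
      a≡2a′ : a ≡ 2 ℕ.* a′
      a≡2a′ = trans a≡a′2 (ℕ.*-comm a′ 2)
      b≡2b′ : b ≡ 2 ℕ.* b′
      b≡2b′ = trans b≡b′2 (ℕ.*-comm b′ 2)
      decide : Dec (2 ℕ.∣ b′) → G⋆-cyclic (P ℕ.* Q)
      decide (no 2∤b′) = primitiveRoots⇒cyclic 1<Q 2∤Q P⊥Q rootP (subst (PrimitiveRoot Q h) b≡2b′ rootQ) 2∤b′
        λ (e∣a , e∣b′) → odd∣2⇒≡1 2∤b′ e∣b′ (common∣2 e∣a (subst (_ ℕ.∣_) (sym b≡2b′) (ℕ.∣n⇒∣m*n 2 e∣b′)))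
      decide (yes 2∣b′) = subst G⋆-cyclic (ℕ.*-comm Q P)
        (primitiveRoots⇒cyclic 1<P 2∤P (unit-sym P⊥Q) rootQ (subst (PrimitiveRoot P g) a≡2a′ rootP) 2∤a′
          λ (e∣b , e∣a′) → odd∣2⇒≡1 2∤a′ e∣a′ (common∣2 (subst (_ ℕ.∣_) (sym a≡2a′) (ℕ.∣n⇒∣m*n 2 e∣a′)) e∣b))
        where
        2∤a′ : ¬ 2 ℕ.∣ a′
        2∤a′ 2∣a′ = ℕ.<⇒≱ (ℕ.m≤m+n 3 1) (ℕ.∣⇒≤ (common∣2
          (subst (4 ℕ.∣_) (sym a≡2a′) (ℕ.*-monoʳ-∣ 2 2∣a′)) (subst (4 ℕ.∣_) (sym b≡2b′) (ℕ.*-monoʳ-∣ 2 2∣b′))))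

  twoPrimePowers⇒cyclic : TwoPrimePowers n → G⋆-cyclic n
  twoPrimePowers⇒cyclic (p , q , suc α , suc β , pp , pq , 2∤p , 2∤q , p≢q , _ , _ , refl , gcd≡2) =
    conclude (prime-power⇒primitiveRoot pp 2∤p α) (prime-power⇒primitiveRoot pq 2∤q β)
    where
    P = p ℕ.^ suc α
    Q = q ℕ.^ suc β
    p∤Q : ¬ p ℕ.∣ Q
    p∤Q p∣Q = contradiction (coprime-^ˡ {q} {p} (suc β) (prime∤⇒coprime pq λ q∣p → p≢q (sym (prime∣⇒≡ pq pp q∣p)))
      (p∣Q , ℕ.∣-refl)) (λ p≡1 → ℕ.<⇒≢ (prime⇒1< pp) (sym p≡1))
    conclude : (∃ λ g → ∃ λ a → PrimitiveRoot P g a) → (∃ λ h → ∃ λ b → PrimitiveRoot Q h b) → G⋆-cyclic (P ℕ.* Q)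
    conclude (_ , _ , rootP) (_ , _ , rootQ) = primitiveRoots-gcd≡2⇒cyclic (1<p^ pp α) (1<p^ pq β)
      (2∤⇒2∤^ (suc α) 2∤p) (2∤⇒2∤^ (suc β) 2∤q) (prime-power-unit (suc α) pp p∤Q) rootP rootQ
      (trans (sym (cong₂ gcd (primitiveRoot⇒φ (1<p^ pp α) rootP) (primitiveRoot⇒φ (1<p^ pq β) rootQ))) gcd≡2)

open import Data.Nat using (_*_; _^_; _<_; _≥_)
open import Data.Nat.Divisibility using (_∣_)
open Classification using (cyclic⇒form; primePower⇒cyclic; twoPrimePowers⇒cyclic)

theorem3 : (n : ℕ) → 1 < n → ¬ (2 ∣ n) →
    (G⋆-cyclic n ⇔
    ((Σ ℕ λ p → Σ ℕ λ α → Prime p × ¬ (2 ∣ p) × α ≥ 1 × n ≡ p ^ α)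
    ⊎ (Σ ℕ λ p → Σ ℕ λ q → Σ ℕ λ α → Σ ℕ λ β →
    Prime p × Prime q × ¬ (2 ∣ p) × ¬ (2 ∣ q) × p ≢ q × α ≥ 1 × β ≥ 1 ×
    n ≡ p ^ α * q ^ β × gcd (φ (p ^ α)) (φ (q ^ β)) ≡ 2)))
theorem3 n 1<n 2∤n = mk⇔ (cyclic⇒form 1<n 2∤n) [ primePower⇒cyclic , twoPrimePowers⇒cyclic ]′
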